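{- Let $f \in \mathbb{Z}[x]$ be monic, quadratic, and irreducible over $\mathbb{Q}$, and write $f = (x - \gamma)^2 + \gamma + m$. Suppose that $|m| > 6 + 3\sqrt{|\gamma| + 1}$ (if $\gamma \in \mathbb{Z}$, it suffices that $|m| > 1 + \sqrt{|\gamma| + 1}$), and that $$\frac{ -m \pm \sqrt{f^2(\gamma)}}{2} \notin \mathbb{Q}^{*2}$$ (for both choices of sign). Then $f$ is stable, i.e. $f^n$ is irreducible over $\mathbb{Q}$ for all $n \geq 1$.
   Context: $f^n$ denotes the $n$-th iterate of $f$ under composition. $\mathbb{Q}^{*2}$ denotes the set of squares of nonzero rational numbers. -}

module Defs where

open import Data.Nat using (ℕ; zero; suc; _≤_)
open import Data.Integer using (ℤ; +_)
open import Data.Rational using (ℚ; 0ℚ; 1ℚ; _+_; _*_; _-_; -_; _<_; ∣_∣; _/_; ½)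
open import Data.List using (List; []; _∷_)
open import Data.Product using (_×_; ∃)
open import Data.Sum using (_⊎_)
open import Relation.Binary.PropositionalEquality using (_≡_)
open import Relation.Nullary using (¬_)

-- Polynomials over ℚ as coefficient lists, lowest degree first
-- (trailing zeros allowed; equality is coefficientwise).
Poly : Set
Poly = List ℚ

coeff : Poly → ℕ → ℚ
coeff []      _       = 0ℚ
coeff (a ∷ p) zero    = a
coeff (a ∷ p) (suc i) = coeff p i

_≈ₚ_ : Poly → Poly → Set
p ≈ₚ q = ∀ i → coeff p i ≡ coeff q i

_+ₚ_ : Poly → Poly → Poly
[]      +ₚ q       = q
(a ∷ p) +ₚ []      = a ∷ p
(a ∷ p) +ₚ (b ∷ q) = (a + b) ∷ (p +ₚ q)

scaleₚ : ℚ → Poly → Poly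
scaleₚ c []      = []
scaleₚ c (a ∷ p) = (c * a) ∷ scaleₚ c p

_*ₚ_ : Poly → Poly → Poly
[]      *ₚ q = []
(a ∷ p) *ₚ q = scaleₚ a q +ₚ (0ℚ ∷ (p *ₚ q))

_∘ₚ_ : Poly → Poly → Poly
[]      ∘ₚ q = []
(a ∷ p) ∘ₚ q = (a ∷ []) +ₚ (q *ₚ (p ∘ₚ q))

Xₚ : Poly
Xₚ = 0ℚ ∷ 1ℚ ∷ []

iterₚ : Poly → ℕ → Poly
iterₚ f zero    = Xₚ
iterₚ f (suc n) = f ∘ₚ iterₚ f n

eval : Poly → ℚ → ℚ
eval []      x = 0ℚ
eval (a ∷ p) x = a + x * eval p x

IsConst : Poly → Set
IsConst p = ∀ i → 1 ≤ i → coeff p i ≡ 0ℚ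

-- irreducible in ℚ[x]: non-constant (so nonzero, non-unit) and in every
-- factorisation f = g h one factor is constant (hence a unit).
Irreducible : Poly → Set
Irreducible f = (¬ IsConst f) × (∀ g h → f ≈ₚ (g *ₚ h) → IsConst g ⊎ IsConst h)

ℤtoℚ : ℤ → ℚ
ℤtoℚ k = k / 1

quadₚ : ℤ → ℤ → Poly
quadₚ b c = ℤtoℚ c ∷ ℤtoℚ b ∷ 1ℚ ∷ []

-- writing f = (x - γ)² + γ + m :  γ = -b/2,  m = c - γ² - γ
gammaOf : ℤ → ℚ
gammaOf b = - (½ * ℤtoℚ b)

mOf : ℤ → ℤ → ℚ
mOf b c = ℤtoℚ c - gammaOf b * gammaOf b - gammaOf b

-- √a < r  (for a ≥ 0), expressed without reals: r > 0 and a < r²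
SqrtLt : ℚ → ℚ → Set
SqrtLt a r = (0ℚ < r) × (a < r * r)

IsNonzeroRatSquare : ℚ → Set
IsNonzeroRatSquare q = ∃ λ t → ¬ (t ≡ 0ℚ) × (t * t ≡ q)

IsInteger : ℚ → Set
IsInteger q = ∃ λ (k : ℤ) → q ≡ ℤtoℚ k

Stable : Poly → Set
Stable f = ∀ n → 1 ≤ n → Irreducible (iterₚ f n)

{-# OPTIONS --safe #-}
module Submission where

-- Put κ = γ + m = f(γ), z = x − γ and w = t − κ, so that z² = w(f) and ℚ[x] = ℚ[f] ⊕ z ℚ[f] is
-- ℚ[f] with a square root of w(f) adjoined. Let P = fⁿ be irreducible and P(f) = h k. The norms
-- N(A + B √w) = A² − w B² of h and k multiply to P², so by Euclid's lemma either one of them is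
-- constant, and then so is h or k, or one of them is u P with u constant. In the latter case P has
-- even degree while w B² has odd degree, so u is the square of the leading coefficient of A, and
-- evaluating at κ, the root of w, shows that P(κ) = fⁿ⁺¹(γ) is a rational square.
-- For n = 1 the equation N(A + B √w) = u f makes (−m + s)/2 a nonzero square with s² = f²(γ).
-- For n ≥ 2 write fⁿ⁺¹(γ) = a² + κ with a = fⁿ(γ) − γ. After clearing denominators (powers of 4, or
-- none when γ is an integer) the bound on |m| makes κ too small compared with the distance from a²
-- to the next square.

-- This is Capelli's lemma without number fields: for a root β of P, f - β = z² - (β - κ) splits
-- over ℚ(β) only if w(β) = β - κ is a square there, and A² - w B² = u P says so inside ℚ[x].
-- Evaluating at κ discards B, so it refutes the equation only if P(κ) is not a square. For n = 1,
-- P(κ) = m² + κ may well be one: |γ| can be of the order of m², so κ may exceed the gap of about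
-- 2|m| between squares near m². Keeping B leads to the hypothesis on (-m ± √f²(γ))/2 instead. For n
-- ≥ 2 the number a is of order m² at least, and the bound on |m| lets 2|a| outgrow |κ| ≤ |m| + |γ|.
-- If γ is only half-integral, denominators cost more: when D clears that of a, D² |κ| has to stay
-- below about 2 D |a|, and D is squared at every step. Then |a| must be shown to grow in proportion
-- to D, and the stronger bound on |m| provides for this.

open import Defs
open import Algebra.Bundles using (CommutativeRing)
open import Algebra.Structures using (IsCommutativeRing)
import Algebra.Solver.Ring as RingSolver
import Algebra.Solver.Ring.AlmostCommutativeRing as ACR
import Algebra.Solver.Ring.NaturalCoefficients.Default as SemiringSolver
open import Data.Bool using (T)
open import Data.Empty using (⊥; ⊥-elim)
open import Data.Integer using (ℤ; +_; -[1+_])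
import Data.Integer as ℤ
import Data.Integer.Properties as ℤP
open import Data.List using ([]; _∷_; length)
open import Data.Maybe using (Maybe; is-just; to-witness-T)
import Data.Maybe as Maybe
open import Data.Nat using (ℕ; zero; suc; _≤_; z≤n; s≤s)
import Data.Nat as ℕ
import Data.Nat.Coprimality as Coprimality
import Data.Nat.Divisibility as ℕD
import Data.Nat.Properties as ℕP
open import Data.Nat.Solver using () renaming (module +-*-Solver to ℕS)
open import Data.Product using (_×_; _,_; ∃; ∃₂; proj₁; proj₂)
open import Data.Rational using (ℚ; mkℚ; 0ℚ; 1ℚ; _+_; _*_; _-_; -_; _<_; ∣_∣; _/_; ½; 1/_; ≢-nonZero; toℚᵘ)
import Data.Rational.Properties as ℚP
open import Data.Rational.Solver using () renaming (module +-*-Solver to ℚS)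
open import Data.Rational.Unnormalised using (mkℚᵘ; *≡*; *<*; _≃_)
import Data.Rational.Unnormalised.Properties as ℚᵘP
open import Data.Sum using (_⊎_; inj₁; inj₂; [_,_]′)
import Data.Vec as Vec
open import Data.Vec.N-ary using (N-ary; Eq; curryⁿ; curryⁿ-cong; _$ⁿ_)
open import Level using (0ℓ; _⊔_)
open import Relation.Binary.Bundles using (Setoid)
open import Relation.Binary.Consequences using (dec⇒weaklyDec)
open import Relation.Binary.PropositionalEquality using (_≡_; _≢_; refl; sym; trans; cong; cong₂; subst; subst₂; module ≡-Reasoning)
import Relation.Binary.Reasoning.Setoid as SetoidReasoning
open import Relation.Nullary using (¬_; yes; no)
open import Algebra.Properties.Group ℚP.+-0-group using () renaming (∙-cancelˡ to ℚ-cancelˡ)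

-- The ring ℚ[x]

-- Wrapping _≈ₚ_ in a record lets the two polynomials be inferred from an equality proof.
infix 4 _≋_
record _≋_ (p q : Poly) : Set where
  constructor coeffwise
  field at : p ≈ₚ q
open _≋_ public

≋-refl : ∀ {p} → p ≋ p
≋-refl = coeffwise λ _ → refl

≋-sym : ∀ {p q} → p ≋ q → q ≋ p
≋-sym e = coeffwise λ i → sym (at e i)

≋-trans : ∀ {p q r} → p ≋ q → q ≋ r → p ≋ r
≋-trans e e′ = coeffwise λ i → trans (at e i) (at e′ i)

constₚ : ℚ → Poly
constₚ a = a ∷ []

negₚ : Poly → Poly
negₚ = scaleₚ (- 1ℚ)

coeff-+ : ∀ p q i → coeff (p +ₚ q) i ≡ coeff p i + coeff q i
coeff-+ []      q       i       = sym (ℚP.+-identityˡ _)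
coeff-+ (a ∷ p) []      i       = sym (ℚP.+-identityʳ _)
coeff-+ (a ∷ p) (b ∷ q) zero    = refl
coeff-+ (a ∷ p) (b ∷ q) (suc i) = coeff-+ p q i

coeff-scale : ∀ c p i → coeff (scaleₚ c p) i ≡ c * coeff p i
coeff-scale c []      i       = sym (ℚP.*-zeroʳ c)
coeff-scale c (a ∷ p) zero    = refl
coeff-scale c (a ∷ p) (suc i) = coeff-scale c p i

coeff-neg : ∀ p i → coeff (negₚ p) i ≡ - coeff p i
coeff-neg p i = trans (coeff-scale (- 1ℚ) p i)
  (trans (sym (ℚP.neg-distribˡ-* 1ℚ (coeff p i))) (cong -_ (ℚP.*-identityˡ _)))

∷-cong : ∀ {a b p q} → a ≡ b → p ≋ q → a ∷ p ≋ b ∷ q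
∷-cong a≡b e = coeffwise λ { zero → a≡b ; (suc i) → at e i }

0∷[] : 0ℚ ∷ [] ≋ []
0∷[] = coeffwise λ { zero → refl ; (suc i) → refl }

+ₚ-cong : ∀ {p p′ q q′} → p ≋ p′ → q ≋ q′ → p +ₚ q ≋ p′ +ₚ q′
+ₚ-cong {p} {p′} {q} {q′} e e′ = coeffwise λ i →
  trans (coeff-+ p q i) (trans (cong₂ _+_ (at e i) (at e′ i)) (sym (coeff-+ p′ q′ i)))

scale-cong : ∀ {c d p q} → c ≡ d → p ≋ q → scaleₚ c p ≋ scaleₚ d q
scale-cong {c} {d} {p} {q} c≡d e = coeffwise λ i →
  trans (coeff-scale c p i) (trans (cong₂ _*_ c≡d (at e i)) (sym (coeff-scale d q i)))

negₚ-cong : ∀ {p q} → p ≋ q → negₚ p ≋ negₚ q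
negₚ-cong {p} {q} e = scale-cong { - 1ℚ} { - 1ℚ} {p} {q} refl e

+ₚ-assoc : ∀ p q r → (p +ₚ q) +ₚ r ≋ p +ₚ (q +ₚ r)
+ₚ-assoc p q r = coeffwise λ i → begin
  coeff ((p +ₚ q) +ₚ r) i                  ≡⟨ coeff-+ (p +ₚ q) r i ⟩
  coeff (p +ₚ q) i + coeff r i             ≡⟨ cong (_+ coeff r i) (coeff-+ p q i) ⟩
  coeff p i + coeff q i + coeff r i        ≡⟨ ℚP.+-assoc (coeff p i) _ _ ⟩
  coeff p i + (coeff q i + coeff r i)      ≡⟨ cong (λ c → coeff p i + c) (coeff-+ q r i) ⟨
  coeff p i + coeff (q +ₚ r) i             ≡⟨ coeff-+ p (q +ₚ r) i ⟨
  coeff (p +ₚ (q +ₚ r)) i                  ∎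
  where open ≡-Reasoning

+ₚ-comm : ∀ p q → p +ₚ q ≋ q +ₚ p
+ₚ-comm p q = coeffwise λ i →
  trans (coeff-+ p q i) (trans (ℚP.+-comm (coeff p i) _) (sym (coeff-+ q p i)))

+ₚ-identityʳ : ∀ p → p +ₚ [] ≋ p
+ₚ-identityʳ p = +ₚ-comm p []

+ₚ-inverseˡ : ∀ p → negₚ p +ₚ p ≋ []
+ₚ-inverseˡ p = coeffwise λ i →
  trans (coeff-+ (negₚ p) p i) (trans (cong (_+ coeff p i) (coeff-neg p i)) (ℚP.+-inverseˡ (coeff p i)))

+ₚ-inverseʳ : ∀ p → p +ₚ negₚ p ≋ []
+ₚ-inverseʳ p = ≋-trans (+ₚ-comm p (negₚ p)) (+ₚ-inverseˡ p)

scale-distrib-+ : ∀ c p q → scaleₚ c (p +ₚ q) ≋ scaleₚ c p +ₚ scaleₚ c q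
scale-distrib-+ c p q = coeffwise λ i → begin
  coeff (scaleₚ c (p +ₚ q)) i                        ≡⟨ coeff-scale c (p +ₚ q) i ⟩
  c * coeff (p +ₚ q) i                               ≡⟨ cong (c *_) (coeff-+ p q i) ⟩
  c * (coeff p i + coeff q i)                        ≡⟨ ℚP.*-distribˡ-+ c _ _ ⟩
  c * coeff p i + c * coeff q i                      ≡⟨ cong₂ _+_ (coeff-scale c p i) (coeff-scale c q i) ⟨
  coeff (scaleₚ c p) i + coeff (scaleₚ c q) i        ≡⟨ coeff-+ (scaleₚ c p) (scaleₚ c q) i ⟨
  coeff (scaleₚ c p +ₚ scaleₚ c q) i                 ∎
  where open ≡-Reasoning

scale-scale : ∀ c d p → scaleₚ c (scaleₚ d p) ≋ scaleₚ (c * d) p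
scale-scale c d p = coeffwise λ i → begin
  coeff (scaleₚ c (scaleₚ d p)) i ≡⟨ coeff-scale c (scaleₚ d p) i ⟩
  c * coeff (scaleₚ d p) i        ≡⟨ cong (c *_) (coeff-scale d p i) ⟩
  c * (d * coeff p i)             ≡⟨ ℚP.*-assoc c d _ ⟨
  c * d * coeff p i               ≡⟨ coeff-scale (c * d) p i ⟨
  coeff (scaleₚ (c * d) p) i      ∎
  where open ≡-Reasoning

scale-zero : ∀ p → scaleₚ 0ℚ p ≋ []
scale-zero p = coeffwise λ i → trans (coeff-scale 0ℚ p i) (ℚP.*-zeroˡ (coeff p i))

scale-one : ∀ p → scaleₚ 1ℚ p ≋ p
scale-one p = coeffwise λ i → trans (coeff-scale 1ℚ p i) (ℚP.*-identityˡ (coeff p i))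

≋-setoid : Setoid 0ℓ 0ℓ
≋-setoid = record
  { Carrier = Poly ; _≈_ = _≋_
  ; isEquivalence = record { refl = ≋-refl ; sym = ≋-sym ; trans = ≋-trans } }

module ≋-Reasoning = SetoidReasoning ≋-setoid

+ₚ-interchange : ∀ p q r s → (p +ₚ q) +ₚ (r +ₚ s) ≋ (p +ₚ r) +ₚ (q +ₚ s)
+ₚ-interchange p q r s = begin
  (p +ₚ q) +ₚ (r +ₚ s) ≈⟨ +ₚ-assoc p q (r +ₚ s) ⟩
  p +ₚ (q +ₚ (r +ₚ s)) ≈⟨ +ₚ-cong (≋-refl {p}) (+ₚ-assoc q r s) ⟨
  p +ₚ ((q +ₚ r) +ₚ s) ≈⟨ +ₚ-cong (≋-refl {p}) (+ₚ-cong (+ₚ-comm q r) (≋-refl {s})) ⟩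
  p +ₚ ((r +ₚ q) +ₚ s) ≈⟨ +ₚ-cong (≋-refl {p}) (+ₚ-assoc r q s) ⟩
  p +ₚ (r +ₚ (q +ₚ s)) ≈⟨ +ₚ-assoc p r (q +ₚ s) ⟨
  (p +ₚ r) +ₚ (q +ₚ s) ∎
  where open ≋-Reasoning

*ₚ-congˡ : ∀ p {q q′} → q ≋ q′ → p *ₚ q ≋ p *ₚ q′
*ₚ-congˡ []      e = ≋-refl
*ₚ-congˡ (a ∷ p) e = +ₚ-cong (scale-cong {a} refl e) (∷-cong refl (*ₚ-congˡ p e))

*ₚ-zeroʳ : ∀ p → p *ₚ [] ≋ []
*ₚ-zeroʳ []      = ≋-refl
*ₚ-zeroʳ (a ∷ p) = ≋-trans (∷-cong refl (*ₚ-zeroʳ p)) 0∷[]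

-- The product recurses on its left factor. This is the matching recursion on the right factor, and
-- commutativity is the comparison of the two.
*ₚ-∷ : ∀ p b q → p *ₚ (b ∷ q) ≋ scaleₚ b p +ₚ (0ℚ ∷ (p *ₚ q))
*ₚ-∷ []      b q = ≋-sym 0∷[]
*ₚ-∷ (a ∷ p) b q = ∷-cong (cong (_+ 0ℚ) (ℚP.*-comm a b)) (begin
  scaleₚ a q +ₚ (p *ₚ (b ∷ q))                   ≈⟨ +ₚ-cong (≋-refl {scaleₚ a q}) (*ₚ-∷ p b q) ⟩
  scaleₚ a q +ₚ (scaleₚ b p +ₚ (0ℚ ∷ (p *ₚ q)))  ≈⟨ +ₚ-assoc (scaleₚ a q) (scaleₚ b p) _ ⟨
  (scaleₚ a q +ₚ scaleₚ b p) +ₚ (0ℚ ∷ (p *ₚ q))  ≈⟨ +ₚ-cong (+ₚ-comm (scaleₚ a q) (scaleₚ b p)) (≋-refl {0ℚ ∷ (p *ₚ q)}) ⟩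
  (scaleₚ b p +ₚ scaleₚ a q) +ₚ (0ℚ ∷ (p *ₚ q))  ≈⟨ +ₚ-assoc (scaleₚ b p) (scaleₚ a q) _ ⟩
  scaleₚ b p +ₚ ((a ∷ p) *ₚ q)                   ∎)
  where open ≋-Reasoning

*ₚ-comm : ∀ p q → p *ₚ q ≋ q *ₚ p
*ₚ-comm []      q = ≋-sym (*ₚ-zeroʳ q)
*ₚ-comm (a ∷ p) q = ≋-trans (+ₚ-cong (≋-refl {scaleₚ a q}) (∷-cong refl (*ₚ-comm p q))) (≋-sym (*ₚ-∷ q a p))

*ₚ-cong : ∀ {p p′ q q′} → p ≋ p′ → q ≋ q′ → p *ₚ q ≋ p′ *ₚ q′
*ₚ-cong {p} {p′} {q} {q′} e e′ = begin
  p *ₚ q   ≈⟨ *ₚ-congˡ p e′ ⟩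
  p *ₚ q′  ≈⟨ *ₚ-comm p q′ ⟩
  q′ *ₚ p  ≈⟨ *ₚ-congˡ q′ e ⟩
  q′ *ₚ p′ ≈⟨ *ₚ-comm q′ p′ ⟩
  p′ *ₚ q′ ∎
  where open ≋-Reasoning

*ₚ-distribˡ-+ₚ : ∀ p q r → p *ₚ (q +ₚ r) ≋ (p *ₚ q) +ₚ (p *ₚ r)
*ₚ-distribˡ-+ₚ []      q r = ≋-refl
*ₚ-distribˡ-+ₚ (a ∷ p) q r = begin
  scaleₚ a (q +ₚ r) +ₚ (0ℚ ∷ (p *ₚ (q +ₚ r)))
    ≈⟨ +ₚ-cong (scale-distrib-+ a q r) (∷-cong refl (*ₚ-distribˡ-+ₚ p q r)) ⟩
  (scaleₚ a q +ₚ scaleₚ a r) +ₚ ((0ℚ ∷ (p *ₚ q)) +ₚ (0ℚ ∷ (p *ₚ r)))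
    ≈⟨ +ₚ-interchange (scaleₚ a q) (scaleₚ a r) _ _ ⟩
  ((a ∷ p) *ₚ q) +ₚ ((a ∷ p) *ₚ r) ∎
  where open ≋-Reasoning

*ₚ-distribʳ-+ₚ : ∀ r p q → (p +ₚ q) *ₚ r ≋ (p *ₚ r) +ₚ (q *ₚ r)
*ₚ-distribʳ-+ₚ r p q = begin
  (p +ₚ q) *ₚ r          ≈⟨ *ₚ-comm (p +ₚ q) r ⟩
  r *ₚ (p +ₚ q)          ≈⟨ *ₚ-distribˡ-+ₚ r p q ⟩
  (r *ₚ p) +ₚ (r *ₚ q)   ≈⟨ +ₚ-cong (*ₚ-comm r p) (*ₚ-comm r q) ⟩
  (p *ₚ r) +ₚ (q *ₚ r)   ∎
  where open ≋-Reasoning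

scale-*ₚ : ∀ c p q → scaleₚ c p *ₚ q ≋ scaleₚ c (p *ₚ q)
scale-*ₚ c []      q = ≋-refl
scale-*ₚ c (a ∷ p) q = begin
  scaleₚ (c * a) q +ₚ (0ℚ ∷ (scaleₚ c p *ₚ q))
    ≈⟨ +ₚ-cong (≋-sym (scale-scale c a q)) (∷-cong (sym (ℚP.*-zeroʳ c)) (scale-*ₚ c p q)) ⟩
  scaleₚ c (scaleₚ a q) +ₚ scaleₚ c (0ℚ ∷ (p *ₚ q))
    ≈⟨ scale-distrib-+ c (scaleₚ a q) _ ⟨
  scaleₚ c ((a ∷ p) *ₚ q) ∎
  where open ≋-Reasoning

0∷-*ₚ : ∀ p q → (0ℚ ∷ p) *ₚ q ≋ 0ℚ ∷ (p *ₚ q)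
0∷-*ₚ p q = +ₚ-cong (scale-zero q) (≋-refl {0ℚ ∷ (p *ₚ q)})

*ₚ-assoc : ∀ p q r → (p *ₚ q) *ₚ r ≋ p *ₚ (q *ₚ r)
*ₚ-assoc []      q r = ≋-refl
*ₚ-assoc (a ∷ p) q r = begin
  (scaleₚ a q +ₚ (0ℚ ∷ (p *ₚ q))) *ₚ r
    ≈⟨ *ₚ-distribʳ-+ₚ r (scaleₚ a q) _ ⟩
  (scaleₚ a q *ₚ r) +ₚ ((0ℚ ∷ (p *ₚ q)) *ₚ r)
    ≈⟨ +ₚ-cong (scale-*ₚ a q r) (≋-trans (0∷-*ₚ (p *ₚ q) r) (∷-cong refl (*ₚ-assoc p q r))) ⟩
  (a ∷ p) *ₚ (q *ₚ r) ∎
  where open ≋-Reasoning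

constₚ-*ₚ : ∀ c q → constₚ c *ₚ q ≋ scaleₚ c q
constₚ-*ₚ c q = ≋-trans (+ₚ-cong (≋-refl {scaleₚ c q}) 0∷[]) (+ₚ-identityʳ (scaleₚ c q))

*ₚ-identityˡ : ∀ q → constₚ 1ℚ *ₚ q ≋ q
*ₚ-identityˡ q = ≋-trans (constₚ-*ₚ 1ℚ q) (scale-one q)

*ₚ-identityʳ : ∀ q → q *ₚ constₚ 1ℚ ≋ q
*ₚ-identityʳ q = ≋-trans (*ₚ-comm q (constₚ 1ℚ)) (*ₚ-identityˡ q)

+ₚ-*ₚ-isCommutativeRing : IsCommutativeRing _≋_ _+ₚ_ _*ₚ_ negₚ [] (constₚ 1ℚ)
+ₚ-*ₚ-isCommutativeRing = record
  { isRing = record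
    { +-isAbelianGroup = record
      { isGroup = record
        { isMonoid = record
          { isSemigroup = record
            { isMagma = record
              { isEquivalence = Setoid.isEquivalence ≋-setoid
              ; ∙-cong = +ₚ-cong }
            ; assoc = +ₚ-assoc }
          ; identity = (λ _ → ≋-refl) , +ₚ-identityʳ }
        ; inverse = +ₚ-inverseˡ , +ₚ-inverseʳ
        ; ⁻¹-cong = negₚ-cong }
      ; comm = +ₚ-comm }
    ; *-cong = *ₚ-cong
    ; *-assoc = *ₚ-assoc
    ; *-identity = *ₚ-identityˡ , *ₚ-identityʳ
    ; distrib = *ₚ-distribˡ-+ₚ , *ₚ-distribʳ-+ₚ }
  ; *-comm = *ₚ-comm }

polyRing : CommutativeRing 0ℓ 0ℓ
polyRing = record { isCommutativeRing = +ₚ-*ₚ-isCommutativeRing }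

-- A ring solver for ℚ[x] with rational constants

constₚ-* : ∀ a b → constₚ (a * b) ≋ constₚ a *ₚ constₚ b
constₚ-* a b = ∷-cong (sym (ℚP.+-identityʳ (a * b))) ≋-refl

constₚ-neg : ∀ a → constₚ (- a) ≋ negₚ (constₚ a)
constₚ-neg a = coeffwise λ { zero → sym (coeff-neg (constₚ a) 0) ; (suc i) → refl }

private
  polyACR : ACR.AlmostCommutativeRing 0ℓ 0ℓ
  polyACR = ACR.fromCommutativeRing polyRing

  ℚ→poly : ACR.AlmostCommutativeRing.rawRing (ACR.fromCommutativeRing ℚP.+-*-commutativeRing)
             ACR.-Raw-AlmostCommutative⟶ polyACR
  ℚ→poly = record
    { ⟦_⟧    = constₚ
    ; +-homo = λ a b → ≋-refl
    ; *-homo = constₚ-*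
    ; -‿homo = constₚ-neg
    ; 0-homo = 0∷[]
    ; 1-homo = ≋-refl }

  constₚ-cong? : ∀ a b → Maybe (constₚ a ≋ constₚ b)
  constₚ-cong? a b = Maybe.map (λ e → ∷-cong e ≋-refl) (dec⇒weaklyDec ℚP._≟_ a b)

private module PS = RingSolver _ polyACR ℚ→poly constₚ-cong?
open PS public using (Polynomial; var) renaming (con to conₚ; _:+_ to _⊞_; _:*_ to _⊠_; _:-_ to _⊟_; _:=_ to _⊜_)

sameNormalForm : ∀ {n} (l r : Polynomial n) → Maybe (PS.normalise l PS.≈N PS.normalise r)
sameNormalForm l r = PS.normalise l PS.≟N PS.normalise r

solve-at : ∀ n (l r : Polynomial n) → T (is-just (sameNormalForm l r)) → ∀ ρ → PS.⟦ l ⟧ ρ ≋ PS.⟦ r ⟧ ρ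
solve-at n l r ok ρ = PS.prove ρ l r (PS.⟦ to-witness-T (sameNormalForm l r) ok ⟧N-cong ρ)

-- Unlike the library's solve, this compares normal forms as closed terms with coefficients
-- in ℚ; comparing their values would unfold the operations on coefficient lists.
solveₚ : ∀ n (f : N-ary n (Polynomial n) (Polynomial n × Polynomial n)) →
         (let l , r = f $ⁿ Vec.map var (Vec.allFin n)) →
         {T (is-just (sameNormalForm l r))} →
         Eq n _≋_ (curryⁿ PS.⟦ l ⟧) (curryⁿ PS.⟦ r ⟧)
solveₚ n f {ok} = curryⁿ-cong _≋_ PS.⟦ proj₁ lr ⟧ PS.⟦ proj₂ lr ⟧ (solve-at n (proj₁ lr) (proj₂ lr) ok)
  where lr = f $ⁿ Vec.map var (Vec.allFin n)

-- Degree, division and Euclid's lemma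

ℚ-inverse : ∀ {x} → x ≢ 0ℚ → ∃ λ y → y * x ≡ 1ℚ
ℚ-inverse {x} x≢0 = 1/ x , ℚP.*-inverseˡ x
  where instance _ = ≢-nonZero x≢0

ℚ-integral : ∀ x y → x * y ≡ 0ℚ → x ≢ 0ℚ → y ≡ 0ℚ
ℚ-integral x y xy≡0 x≢0 with x⁻¹ , x⁻¹x≡1 ← ℚ-inverse x≢0 = begin
  y             ≡⟨ ℚP.*-identityˡ y ⟨
  1ℚ * y        ≡⟨ cong (_* y) x⁻¹x≡1 ⟨
  x⁻¹ * x * y   ≡⟨ ℚP.*-assoc x⁻¹ x y ⟩
  x⁻¹ * (x * y) ≡⟨ cong (x⁻¹ *_) xy≡0 ⟩
  x⁻¹ * 0ℚ      ≡⟨ ℚP.*-zeroʳ x⁻¹ ⟩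
  0ℚ            ∎
  where open ≡-Reasoning

1≢0 : 1ℚ ≢ 0ℚ
1≢0 ()

-- A strict bound in place of a degree: it makes sense for the zero polynomial and for lists with
-- trailing zeros, and `DegLt p 1` is definitionally `IsConst p`.
DegLt : Poly → ℕ → Set
DegLt p n = ∀ i → n ≤ i → coeff p i ≡ 0ℚ

HasDeg : Poly → ℕ → Set
HasDeg p n = DegLt p (suc n) × coeff p n ≢ 0ℚ

degLt-cong : ∀ {p q} n → p ≋ q → DegLt p n → DegLt q n
degLt-cong n e d i n≤i = trans (sym (at e i)) (d i n≤i)

degLt-mono : ∀ p {m n} → m ≤ n → DegLt p m → DegLt p n
degLt-mono p m≤n d i n≤i = d i (ℕP.≤-trans m≤n n≤i)

degLt-tail : ∀ a p n → DegLt (a ∷ p) (suc n) → DegLt p n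
degLt-tail a p n d i n≤i = d (suc i) (s≤s n≤i)

degLt0⇒≋[] : ∀ p → DegLt p 0 → p ≋ []
degLt0⇒≋[] p d = coeffwise λ i → d i z≤n

degLt-pred : ∀ p n → DegLt p (suc n) → coeff p n ≡ 0ℚ → DegLt p n
degLt-pred p n d z i n≤i with ℕP.m≤n⇒m<n∨m≡n n≤i
... | inj₁ n<i  = d i n<i
... | inj₂ refl = z

degLt-scale : ∀ c p n → DegLt p n → DegLt (scaleₚ c p) n
degLt-scale c p n d i n≤i = trans (coeff-scale c p i) (trans (cong (c *_) (d i n≤i)) (ℚP.*-zeroʳ c))

degLt-+ : ∀ p q n → DegLt p n → DegLt q n → DegLt (p +ₚ q) n
degLt-+ p q n d d′ i n≤i = trans (coeff-+ p q i) (cong₂ _+_ (d i n≤i) (d′ i n≤i))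

coeff-scale+0∷ : ∀ a q r i → coeff (scaleₚ a q +ₚ (0ℚ ∷ r)) (suc i) ≡ a * coeff q (suc i) + coeff r i
coeff-scale+0∷ a q r i = trans (coeff-+ (scaleₚ a q) (0ℚ ∷ r) (suc i)) (cong (_+ coeff r i) (coeff-scale a q (suc i)))

degLt-* : ∀ p q m n → DegLt p (suc m) → DegLt q (suc n) → DegLt (p *ₚ q) (suc (m ℕ.+ n))
degLt-* []      q m       n d d′ i       _       = refl
degLt-* (a ∷ p) q zero    n d d′ (suc i) n<i =
  trans (coeff-scale+0∷ a q (p *ₚ q) i)
    (trans (cong₂ _+_ (trans (cong (a *_) (d′ (suc i) n<i)) (ℚP.*-zeroʳ a))
                      (at (*ₚ-cong (degLt0⇒≋[] p (degLt-tail a p 0 d)) (≋-refl {q})) i))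
      refl)
degLt-* (a ∷ p) q (suc m) n d d′ (suc i) (s≤s m+n<i) =
  trans (coeff-scale+0∷ a q (p *ₚ q) i)
    (trans (cong₂ _+_ (trans (cong (a *_) (d′ (suc i) (s≤s (ℕP.≤-trans (ℕP.m≤n+m n (suc m)) m+n<i)))) (ℚP.*-zeroʳ a))
                      (degLt-* p q m n (degLt-tail a p (suc m) d) d′ i m+n<i))
      refl)

-- Bounds suffice and the two coefficients may vanish: the degree descent for norms reads off
-- coefficients before it is known which of them are zero.
coeff-*-top : ∀ p q m n → DegLt p (suc m) → DegLt q (suc n) →
              coeff (p *ₚ q) (m ℕ.+ n) ≡ coeff p m * coeff q n
coeff-*-top []      q m       n d d′ = sym (ℚP.*-zeroˡ (coeff q n))
coeff-*-top (a ∷ p) q zero    n d d′ =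
  trans (at (+ₚ-cong (≋-refl {scaleₚ a q})
          (≋-trans (∷-cong refl (*ₚ-cong (degLt0⇒≋[] p (degLt-tail a p 0 d)) (≋-refl {q}))) 0∷[])) n)
    (trans (at (+ₚ-identityʳ (scaleₚ a q)) n) (coeff-scale a q n))
coeff-*-top (a ∷ p) q (suc m) n d d′ =
  trans (coeff-scale+0∷ a q (p *ₚ q) (m ℕ.+ n))
    (trans (cong₂ _+_ (trans (cong (a *_) (d′ (suc (m ℕ.+ n)) (s≤s (ℕP.m≤n+m n m)))) (ℚP.*-zeroʳ a))
                      (coeff-*-top p q m n (degLt-tail a p (suc m) d) d′))
      (ℚP.+-identityˡ _))

hasDeg-* : ∀ p q m n → HasDeg p m → HasDeg q n → HasDeg (p *ₚ q) (m ℕ.+ n)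
hasDeg-* p q m n (d , l) (d′ , l′) = degLt-* p q m n d d′ , λ z →
  l′ (ℚ-integral (coeff p m) (coeff q n) (trans (sym (coeff-*-top p q m n d d′)) z) l)

-- Decidable equality in ℚ strips trailing zeros; this stands in for a degree function.
zeroOrHasDeg : ∀ p → p ≋ [] ⊎ ∃ (HasDeg p)
zeroOrHasDeg []      = inj₁ ≋-refl
zeroOrHasDeg (a ∷ p) with zeroOrHasDeg p
... | inj₂ (n , d , l) = inj₂ (suc n , (λ { (suc i) (s≤s n<i) → d i n<i }) , l)
... | inj₁ p≋[] with a ℚP.≟ 0ℚ
...   | yes a≡0 = inj₁ (≋-trans (∷-cong a≡0 p≋[]) 0∷[])
...   | no  a≢0 = inj₂ (0 , (λ { (suc i) _ → at p≋[] i }) , a≢0)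

hasDeg⇒≉[] : ∀ p n → HasDeg p n → ¬ p ≋ []
hasDeg⇒≉[] p n (_ , l) e = l (at e n)

hasDeg-≤ : ∀ p m n → HasDeg p m → DegLt p n → suc m ≤ n
hasDeg-≤ p m n (_ , l) d with ℕP.≤-total n m
... | inj₁ n≤m = ⊥-elim (l (d m n≤m))
... | inj₂ m≤n with ℕP.m≤n⇒m<n∨m≡n m≤n
...   | inj₁ m<n  = m<n
...   | inj₂ refl = ⊥-elim (l (d m ℕP.≤-refl))

*ₚ-integral : ∀ p q → p *ₚ q ≋ [] → ¬ p ≋ [] → q ≋ []
*ₚ-integral p q pq≋[] p≉[] with zeroOrHasDeg p | zeroOrHasDeg q
... | inj₁ e       | _             = ⊥-elim (p≉[] e)
... | inj₂ _       | inj₁ e        = e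
... | inj₂ (m , d) | inj₂ (n , d′) = ⊥-elim (hasDeg⇒≉[] (p *ₚ q) (m ℕ.+ n) (hasDeg-* p q m n d d′) pq≋[])

*ₚ-cancelˡ : ∀ p {q r} → ¬ p ≋ [] → p *ₚ q ≋ p *ₚ r → q ≋ r
*ₚ-cancelˡ p {q} {r} p≉[] e = begin
  q                       ≈⟨ solveₚ 2 (λ x y → x ⊜ x ⊟ y ⊞ y) q r ⟩
  (q +ₚ negₚ r) +ₚ r      ≈⟨ +ₚ-cong (*ₚ-integral p (q +ₚ negₚ r) z p≉[]) (≋-refl {r}) ⟩
  r                       ∎
  where
  open ≋-Reasoning
  z : p *ₚ (q +ₚ negₚ r) ≋ []
  z = begin
    p *ₚ (q +ₚ negₚ r)          ≈⟨ solveₚ 3 (λ p q r → p ⊠ (q ⊟ r) ⊜ p ⊠ q ⊟ p ⊠ r) p q r ⟩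
    (p *ₚ q) +ₚ negₚ (p *ₚ r)   ≈⟨ +ₚ-cong e (≋-refl {negₚ (p *ₚ r)}) ⟩
    (p *ₚ r) +ₚ negₚ (p *ₚ r)   ≈⟨ +ₚ-inverseʳ (p *ₚ r) ⟩
    []                          ∎

∷-decompose : ∀ a p → a ∷ p ≋ constₚ a +ₚ (Xₚ *ₚ p)
∷-decompose a p = ≋-sym (begin
  constₚ a +ₚ (Xₚ *ₚ p)                ≈⟨ +ₚ-cong (≋-refl {constₚ a}) (≋-trans (0∷-*ₚ (constₚ 1ℚ) p) (∷-cong refl (*ₚ-identityˡ p))) ⟩
  constₚ a +ₚ (0ℚ ∷ p)                 ≈⟨ ∷-cong (ℚP.+-identityʳ a) ≋-refl ⟩
  a ∷ p                                ∎)
  where open ≋-Reasoning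

-- The quotient is built from the one of the tail: x q′ r + (a + x s′) has remainder of degree
-- at most d, and subtracting a multiple of r kills the coefficient of x^d.
divMod : ∀ r d → HasDeg r d → ∀ p → ∃₂ λ q s → p ≋ (q *ₚ r) +ₚ s × DegLt s d
divMod r d hd []      = [] , [] , ≋-refl , λ _ _ → refl
divMod r d (dr , lr) (a ∷ p) with q , s , e , ds ← divMod r d (dr , lr) p | y , yr≡1 ← ℚ-inverse lr =
  c ∷ q , (a ∷ s) +ₚ negₚ (scaleₚ c r) , eq , degLt-pred ((a ∷ s) +ₚ negₚ (scaleₚ c r)) d (degLt-+ (a ∷ s) (negₚ (scaleₚ c r)) (suc d) ds⁺ dcr) top
  where
  c = coeff (a ∷ s) d * y
  ds⁺ : DegLt (a ∷ s) (suc d)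
  ds⁺ (suc i) (s≤s d≤i) = ds i d≤i
  dcr : DegLt (negₚ (scaleₚ c r)) (suc d)
  dcr = degLt-scale (- 1ℚ) (scaleₚ c r) (suc d) (degLt-scale c r (suc d) dr)
  top : coeff ((a ∷ s) +ₚ negₚ (scaleₚ c r)) d ≡ 0ℚ
  top = begin
    coeff ((a ∷ s) +ₚ negₚ (scaleₚ c r)) d              ≡⟨ coeff-+ (a ∷ s) (negₚ (scaleₚ c r)) d ⟩
    coeff (a ∷ s) d + coeff (negₚ (scaleₚ c r)) d       ≡⟨ cong (λ t → coeff (a ∷ s) d + t) (trans (coeff-neg (scaleₚ c r) d) (cong -_ (coeff-scale c r d))) ⟩
    coeff (a ∷ s) d + - (coeff (a ∷ s) d * y * coeff r d) ≡⟨ cong (λ t → coeff (a ∷ s) d + - t) (trans (ℚP.*-assoc (coeff (a ∷ s) d) y (coeff r d)) (trans (cong (coeff (a ∷ s) d *_) yr≡1) (ℚP.*-identityʳ (coeff (a ∷ s) d)))) ⟩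
    coeff (a ∷ s) d + - coeff (a ∷ s) d                 ≡⟨ ℚP.+-inverseʳ (coeff (a ∷ s) d) ⟩
    0ℚ                                                  ∎
    where open ≡-Reasoning
  eq : a ∷ p ≋ ((c ∷ q) *ₚ r) +ₚ ((a ∷ s) +ₚ negₚ (scaleₚ c r))
  eq = begin
    a ∷ p                                   ≈⟨ ∷-cong (sym (ℚP.+-identityˡ a)) e ⟩
    (0ℚ ∷ (q *ₚ r)) +ₚ (a ∷ s)              ≈⟨ solveₚ 3 (λ t u v → t ⊞ u ⊜ (v ⊞ t) ⊞ (u ⊟ v)) (0ℚ ∷ (q *ₚ r)) (a ∷ s) (scaleₚ c r) ⟩
    ((c ∷ q) *ₚ r) +ₚ ((a ∷ s) +ₚ negₚ (scaleₚ c r)) ∎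
    where
    open ≋-Reasoning

infix 4 _∣ₚ_
_∣ₚ_ : Poly → Poly → Set
p ∣ₚ q = ∃ λ u → q ≋ u *ₚ p

const-≋ : ∀ p → IsConst p → p ≋ constₚ (coeff p 0)
const-≋ p d = coeffwise λ { zero → refl ; (suc i) → d (suc i) (s≤s z≤n) }

constₚ-inverse : ∀ r → HasDeg r 0 → ∃ λ y → constₚ y *ₚ r ≋ constₚ 1ℚ
constₚ-inverse r (d , l) with y , yr≡1 ← ℚ-inverse l = y , (begin
  constₚ y *ₚ r                    ≈⟨ *ₚ-congˡ (constₚ y) (const-≋ r d) ⟩
  constₚ y *ₚ constₚ (coeff r 0)   ≈⟨ constₚ-* y (coeff r 0) ⟨
  constₚ (y * coeff r 0)           ≈⟨ ∷-cong yr≡1 ≋-refl ⟩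
  constₚ 1ℚ                        ∎)
  where open ≋-Reasoning

module _ (P : Poly) (irr : Irreducible P) where

  -- Euclid's algorithm on (P , r), with n bounding the degree of r: each remainder s of P
  -- modulo r again satisfies P ∣ s K, and it is nonzero because P is irreducible.
  private
    cancel-small : ∀ n r e d K → HasDeg P d → HasDeg r e → e ℕ.< n → e ℕ.< d → P ∣ₚ r *ₚ K → P ∣ₚ K
    cancel-small (suc n) r zero d K hP hr _ _ (u , rK≋uP) with y , yr≋1 ← constₚ-inverse r hr =
      constₚ y *ₚ u , (begin
        K                          ≈⟨ *ₚ-identityˡ K ⟨
        constₚ 1ℚ *ₚ K             ≈⟨ *ₚ-cong yr≋1 (≋-refl {K}) ⟨
        (constₚ y *ₚ r) *ₚ K       ≈⟨ *ₚ-assoc (constₚ y) r K ⟩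
        constₚ y *ₚ (r *ₚ K)       ≈⟨ *ₚ-congˡ (constₚ y) rK≋uP ⟩
        constₚ y *ₚ (u *ₚ P)       ≈⟨ *ₚ-assoc (constₚ y) u P ⟨
        (constₚ y *ₚ u) *ₚ P       ∎)
      where open ≋-Reasoning
    cancel-small (suc n) r (suc e) d K hP hr (s≤s e<n) e<d (u , rK≋uP)
      with q , s , P≋qr+s , ds ← divMod r (suc e) hr P
      with zeroOrHasDeg s
    -- A zero remainder would factor `P` as `q *ₚ r`. A constant `q` would leave the degree below
    -- `d`, and `r` has positive degree.
    ... | inj₁ s≋[] = ⊥-elim (absurd (proj₂ irr q r (at P≋qr)))
      where
      P≋qr : P ≋ q *ₚ r
      P≋qr = ≋-trans P≋qr+s (≋-trans (+ₚ-cong (≋-refl {q *ₚ r}) s≋[]) (+ₚ-identityʳ (q *ₚ r)))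
      absurd : IsConst q ⊎ IsConst r → ⊥
      absurd (inj₁ cq) = proj₂ hP (trans (at P≋qr d) (degLt-* q r 0 (suc e) cq (proj₁ hr) d e<d))
      absurd (inj₂ cr) = proj₂ hr (cr (suc e) (s≤s z≤n))
    ... | inj₂ (e′ , hs) = cancel-small n s e′ d K hP hs (ℕP.≤-trans e′<1+e e<n) (ℕP.<-trans e′<1+e e<d)
        (K +ₚ negₚ (q *ₚ u) , (begin
          s *ₚ K
            ≈⟨ solveₚ 4 (λ s K q r → s ⊠ K ⊜ K ⊠ (q ⊠ r ⊞ s) ⊟ q ⊠ (r ⊠ K)) s K q r ⟩
          (K *ₚ ((q *ₚ r) +ₚ s)) +ₚ negₚ (q *ₚ (r *ₚ K))
            ≈⟨ +ₚ-cong (*ₚ-congˡ K (≋-sym P≋qr+s)) (negₚ-cong (*ₚ-congˡ q rK≋uP)) ⟩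
          (K *ₚ P) +ₚ negₚ (q *ₚ (u *ₚ P))
            ≈⟨ solveₚ 4 (λ K P q u → K ⊠ P ⊟ q ⊠ (u ⊠ P) ⊜ (K ⊟ q ⊠ u) ⊠ P) K P q u ⟩
          (K +ₚ negₚ (q *ₚ u)) *ₚ P ∎))
      where
      open ≋-Reasoning
      e′<1+e : e′ ℕ.< suc e
      e′<1+e = hasDeg-≤ s e′ (suc e) hs ds

  irreducible⇒≉[] : ¬ P ≋ []
  irreducible⇒≉[] e = proj₁ irr (λ i _ → at e i)

  irreducible-hasDeg : ∃ (HasDeg P)
  irreducible-hasDeg with zeroOrHasDeg P
  ... | inj₁ e = ⊥-elim (irreducible⇒≉[] e)
  ... | inj₂ h = h

  -- Reducing `H` modulo `P` brings its degree below that of `P`, where the Euclidean descent can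
  -- start.
  irreducible⇒prime : ∀ H K → P ∣ₚ H *ₚ K → P ∣ₚ H ⊎ P ∣ₚ K
  irreducible⇒prime H K (u , HK≋uP)
    with d , hP ← irreducible-hasDeg
    with q , s , H≋qP+s , ds ← divMod P d hP H
    with zeroOrHasDeg s
  ... | inj₁ s≋[] = inj₁ (q , ≋-trans H≋qP+s (≋-trans (+ₚ-cong (≋-refl {q *ₚ P}) s≋[]) (+ₚ-identityʳ (q *ₚ P))))
  ... | inj₂ (e , hs) = inj₂ (cancel-small (suc e) s e d K hP hs ℕP.≤-refl (hasDeg-≤ s e d hs ds)
      (u +ₚ negₚ (q *ₚ K) , (begin
        s *ₚ K
          ≈⟨ solveₚ 4 (λ s K q P → s ⊠ K ⊜ (q ⊠ P ⊞ s) ⊠ K ⊟ (q ⊠ K) ⊠ P) s K q P ⟩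
        (((q *ₚ P) +ₚ s) *ₚ K) +ₚ negₚ ((q *ₚ K) *ₚ P)
          ≈⟨ +ₚ-cong (≋-trans (*ₚ-cong (≋-sym H≋qP+s) (≋-refl {K})) HK≋uP) (≋-refl {negₚ ((q *ₚ K) *ₚ P)}) ⟩
        (u *ₚ P) +ₚ negₚ ((q *ₚ K) *ₚ P)
          ≈⟨ solveₚ 3 (λ u P v → u ⊠ P ⊟ v ⊠ P ⊜ (u ⊟ v) ⊠ P) u P (q *ₚ K) ⟩
        (u +ₚ negₚ (q *ₚ K)) *ₚ P ∎)))
    where
    open ≋-Reasoning

  private
    -- Cancelling `P` from U P K = P P leaves P = U K, a factorisation of an irreducible.
    associate : ∀ H K → H *ₚ K ≋ P *ₚ P → P ∣ₚ H → IsConst K ⊎ ∃ λ u → H ≋ constₚ u *ₚ P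
    associate H K e (U , H≋UP) = split (proj₂ irr U K (at P≋UK))
      where
      open ≋-Reasoning
      PUK≋PP : P *ₚ (U *ₚ K) ≋ P *ₚ P
      PUK≋PP = begin
        P *ₚ (U *ₚ K)   ≈⟨ solveₚ 3 (λ P U K → P ⊠ (U ⊠ K) ⊜ (U ⊠ P) ⊠ K) P U K ⟩
        (U *ₚ P) *ₚ K   ≈⟨ *ₚ-cong H≋UP (≋-refl {K}) ⟨
        H *ₚ K          ≈⟨ e ⟩
        P *ₚ P          ∎
      P≋UK : P ≋ U *ₚ K
      P≋UK = ≋-sym (*ₚ-cancelˡ P {U *ₚ K} {P} irreducible⇒≉[] PUK≋PP)
      split : IsConst U ⊎ IsConst K → IsConst K ⊎ ∃ λ u → H ≋ constₚ u *ₚ P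
      split (inj₁ cU) = inj₂ (coeff U 0 , ≋-trans H≋UP (*ₚ-cong (const-≋ U cU) (≋-refl {P})))
      split (inj₂ cK) = inj₁ cK

  irreducible-square-factors : ∀ H K → H *ₚ K ≋ P *ₚ P →
    (IsConst H ⊎ IsConst K) ⊎ ((∃ λ u → H ≋ constₚ u *ₚ P) ⊎ (∃ λ u → K ≋ constₚ u *ₚ P))
  irreducible-square-factors H K e = [ left , right ]′ (irreducible⇒prime H K (P , e))
    where
    left : P ∣ₚ H → _
    left P∣H = [ (λ cK → inj₁ (inj₂ cK)) , (λ u → inj₂ (inj₁ u)) ]′ (associate H K e P∣H)
    right : P ∣ₚ K → _
    right P∣K = [ (λ cH → inj₁ (inj₁ cH)) , (λ u → inj₂ (inj₂ u)) ]′
                  (associate K H (≋-trans (*ₚ-comm K H) e) P∣K)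

-- Evaluation and composition

-- Horner's rule `ev-∷` and a map `ι` respecting sums and products already make `ev` a ring
-- homomorphism. One proof thus serves both evaluation at a rational and substitution of a
-- polynomial.
record Evaluation {c ℓ} (R : CommutativeRing c ℓ) : Set (c ⊔ ℓ) where
  private module R = CommutativeRing R
  open CommutativeRing R using (Carrier; _≈_; 0#) renaming (_+_ to _⊕_; _*_ to _⊗_)
  field
    ι    : ℚ → Carrier
    ι-0  : ι 0ℚ ≈ 0#
    ι-+  : ∀ a b → ι (a + b) ≈ ι a ⊕ ι b
    ι-*  : ∀ a b → ι (a * b) ≈ ι a ⊗ ι b
    x    : Carrier
    ev   : Poly → Carrier
    ev-[] : ev [] ≈ 0#
    ev-∷  : ∀ a p → ev (a ∷ p) ≈ ι a ⊕ (x ⊗ ev p)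

  private
    module S = SemiringSolver R.commutativeSemiring
    open SetoidReasoning R.setoid
    open S using (_:+_; _:*_; _:=_)

  ev-zero : ∀ p → p ≋ [] → ev p ≈ 0#
  ev-zero []      e = ev-[]
  ev-zero (a ∷ p) e = begin
    ev (a ∷ p)           ≈⟨ ev-∷ a p ⟩
    ι a ⊕ (x ⊗ ev p)     ≈⟨ R.+-cong (R.trans (R.reflexive (cong ι (at e 0))) ι-0) (R.*-congˡ (ev-zero p (coeffwise λ i → at e (suc i)))) ⟩
    0# ⊕ (x ⊗ 0#)        ≈⟨ R.trans (R.+-identityˡ _) (R.zeroʳ x) ⟩
    0#                   ∎

  ev-cong : ∀ p q → p ≋ q → ev p ≈ ev q
  ev-cong []      q       e = R.trans ev-[] (R.sym (ev-zero q (≋-sym e)))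
  ev-cong (a ∷ p) []      e = R.trans (ev-zero (a ∷ p) e) (R.sym ev-[])
  ev-cong (a ∷ p) (b ∷ q) e = begin
    ev (a ∷ p)           ≈⟨ ev-∷ a p ⟩
    ι a ⊕ (x ⊗ ev p)     ≈⟨ R.+-cong (R.reflexive (cong ι (at e 0))) (R.*-congˡ (ev-cong p q (coeffwise λ i → at e (suc i)))) ⟩
    ι b ⊕ (x ⊗ ev q)     ≈⟨ ev-∷ b q ⟨
    ev (b ∷ q)           ∎

  ev-+ : ∀ p q → ev (p +ₚ q) ≈ ev p ⊕ ev q
  ev-+ []      q       = R.sym (R.trans (R.+-congʳ ev-[]) (R.+-identityˡ _))
  ev-+ (a ∷ p) []      = R.sym (R.trans (R.+-congˡ ev-[]) (R.+-identityʳ _))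
  ev-+ (a ∷ p) (b ∷ q) = begin
    ev ((a + b) ∷ (p +ₚ q))                        ≈⟨ ev-∷ (a + b) (p +ₚ q) ⟩
    ι (a + b) ⊕ (x ⊗ ev (p +ₚ q))                  ≈⟨ R.+-cong (ι-+ a b) (R.*-congˡ (ev-+ p q)) ⟩
    (ι a ⊕ ι b) ⊕ (x ⊗ (ev p ⊕ ev q))              ≈⟨ S.solve 5 (λ a b x u v → (a :+ b) :+ x :* (u :+ v) := (a :+ x :* u) :+ (b :+ x :* v)) R.refl (ι a) (ι b) x (ev p) (ev q) ⟩
    (ι a ⊕ (x ⊗ ev p)) ⊕ (ι b ⊕ (x ⊗ ev q))        ≈⟨ R.+-cong (ev-∷ a p) (ev-∷ b q) ⟨
    ev (a ∷ p) ⊕ ev (b ∷ q)                        ∎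

  ev-scale : ∀ d p → ev (scaleₚ d p) ≈ ι d ⊗ ev p
  ev-scale d []      = R.trans ev-[] (R.sym (R.trans (R.*-congˡ ev-[]) (R.zeroʳ (ι d))))
  ev-scale d (a ∷ p) = begin
    ev ((d * a) ∷ scaleₚ d p)                ≈⟨ ev-∷ (d * a) (scaleₚ d p) ⟩
    ι (d * a) ⊕ (x ⊗ ev (scaleₚ d p))        ≈⟨ R.+-cong (ι-* d a) (R.*-congˡ (ev-scale d p)) ⟩
    (ι d ⊗ ι a) ⊕ (x ⊗ (ι d ⊗ ev p))         ≈⟨ S.solve 4 (λ d a x u → d :* a :+ x :* (d :* u) := d :* (a :+ x :* u)) R.refl (ι d) (ι a) x (ev p) ⟩
    ι d ⊗ (ι a ⊕ (x ⊗ ev p))                 ≈⟨ R.*-congˡ (ev-∷ a p) ⟨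
    ι d ⊗ ev (a ∷ p)                         ∎

  ev-* : ∀ p q → ev (p *ₚ q) ≈ ev p ⊗ ev q
  ev-* []      q = R.trans ev-[] (R.sym (R.trans (R.*-congʳ ev-[]) (R.zeroˡ (ev q))))
  ev-* (a ∷ p) q = begin
    ev (scaleₚ a q +ₚ (0ℚ ∷ (p *ₚ q)))             ≈⟨ ev-+ (scaleₚ a q) (0ℚ ∷ (p *ₚ q)) ⟩
    ev (scaleₚ a q) ⊕ ev (0ℚ ∷ (p *ₚ q))           ≈⟨ R.+-cong (ev-scale a q) (R.trans (ev-∷ 0ℚ (p *ₚ q)) (R.trans (R.+-congʳ ι-0) (R.+-identityˡ _))) ⟩
    (ι a ⊗ ev q) ⊕ (x ⊗ ev (p *ₚ q))               ≈⟨ R.+-congˡ (R.*-congˡ (ev-* p q)) ⟩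
    (ι a ⊗ ev q) ⊕ (x ⊗ (ev p ⊗ ev q))             ≈⟨ S.solve 4 (λ a x u v → a :* v :+ x :* (u :* v) := (a :+ x :* u) :* v) R.refl (ι a) x (ev p) (ev q) ⟩
    (ι a ⊕ (x ⊗ ev p)) ⊗ ev q                      ≈⟨ R.*-congʳ (ev-∷ a p) ⟨
    ev (a ∷ p) ⊗ ev q                              ∎

evaluation : ℚ → Evaluation ℚP.+-*-commutativeRing
evaluation x = record
  { ι = λ a → a ; ι-0 = refl ; ι-+ = λ _ _ → refl ; ι-* = λ _ _ → refl
  ; x = x ; ev = λ p → eval p x ; ev-[] = refl ; ev-∷ = λ _ _ → refl }

composition : Poly → Evaluation polyRing
composition q = record
  { ι = constₚ ; ι-0 = 0∷[] ; ι-+ = λ _ _ → ≋-refl ; ι-* = constₚ-*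
  ; x = q ; ev = λ p → p ∘ₚ q ; ev-[] = ≋-refl ; ev-∷ = λ _ _ → ≋-refl }

module Eval (x : ℚ) = Evaluation (evaluation x)
  renaming (ev-cong to eval-cong; ev-+ to eval-+; ev-scale to eval-scale; ev-* to eval-*)

module Comp (q : Poly) = Evaluation (composition q)
  renaming (ev-zero to ∘-zero; ev-cong to ∘-congʳ; ev-+ to ∘-+; ev-scale to ∘-scale; ev-* to ∘-*)

eval-const : ∀ a x → eval (constₚ a) x ≡ a
eval-const a x = trans (cong (λ t → a + t) (ℚP.*-zeroʳ x)) (ℚP.+-identityʳ a)

eval-neg : ∀ p x → eval (negₚ p) x ≡ - eval p x
eval-neg p x = trans (Eval.eval-scale x (- 1ℚ) p)
  (trans (sym (ℚP.neg-distribˡ-* 1ℚ (eval p x))) (cong -_ (ℚP.*-identityˡ (eval p x))))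

eval-∘ : ∀ p q x → eval (p ∘ₚ q) x ≡ eval p (eval q x)
eval-∘ []      q x = refl
eval-∘ (a ∷ p) q x = begin
  eval (constₚ a +ₚ (q *ₚ (p ∘ₚ q))) x           ≡⟨ Eval.eval-+ x (constₚ a) (q *ₚ (p ∘ₚ q)) ⟩
  eval (constₚ a) x + eval (q *ₚ (p ∘ₚ q)) x     ≡⟨ cong₂ _+_ (eval-const a x) (Eval.eval-* x q (p ∘ₚ q)) ⟩
  a + eval q x * eval (p ∘ₚ q) x                 ≡⟨ cong (λ t → a + eval q x * t) (eval-∘ p q x) ⟩
  a + eval q x * eval p (eval q x)               ∎
  where open ≡-Reasoning

∘-congˡ : ∀ p {q q′} → q ≋ q′ → p ∘ₚ q ≋ p ∘ₚ q′
∘-congˡ []      e = ≋-refl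
∘-congˡ (a ∷ p) e = +ₚ-cong (≋-refl {constₚ a}) (*ₚ-cong e (∘-congˡ p e))

const-∘ : ∀ a q → constₚ a ∘ₚ q ≋ constₚ a
const-∘ a q = ≋-trans (+ₚ-cong (≋-refl {constₚ a}) (*ₚ-zeroʳ q)) (+ₚ-identityʳ (constₚ a))

∘-assoc : ∀ p q r → (p ∘ₚ q) ∘ₚ r ≋ p ∘ₚ (q ∘ₚ r)
∘-assoc []      q r = ≋-refl
∘-assoc (a ∷ p) q r = begin
  (constₚ a +ₚ (q *ₚ (p ∘ₚ q))) ∘ₚ r                  ≈⟨ Comp.∘-+ r (constₚ a) (q *ₚ (p ∘ₚ q)) ⟩
  (constₚ a ∘ₚ r) +ₚ ((q *ₚ (p ∘ₚ q)) ∘ₚ r)           ≈⟨ +ₚ-cong (const-∘ a r) (≋-trans (Comp.∘-* r q (p ∘ₚ q)) (*ₚ-congˡ (q ∘ₚ r) (∘-assoc p q r))) ⟩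
  constₚ a +ₚ ((q ∘ₚ r) *ₚ (p ∘ₚ (q ∘ₚ r)))           ∎
  where open ≋-Reasoning

linear-∘ : ∀ a q → (a ∷ 1ℚ ∷ []) ∘ₚ q ≋ q +ₚ constₚ a
linear-∘ a q = begin
  constₚ a +ₚ (q *ₚ (constₚ 1ℚ ∘ₚ q))  ≈⟨ +ₚ-cong (≋-refl {constₚ a}) (*ₚ-congˡ q (const-∘ 1ℚ q)) ⟩
  constₚ a +ₚ (q *ₚ constₚ 1ℚ)         ≈⟨ solveₚ 2 (λ a q → a ⊞ q ⊠ conₚ 1ℚ ⊜ q ⊞ a) (constₚ a) q ⟩
  q +ₚ constₚ a                        ∎
  where open ≋-Reasoning

X-∘ : ∀ q → Xₚ ∘ₚ q ≋ q
X-∘ q = ≋-trans (linear-∘ 0ℚ q) (≋-trans (+ₚ-cong (≋-refl {q}) 0∷[]) (+ₚ-identityʳ q))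

∘-X : ∀ p → p ∘ₚ Xₚ ≋ p
∘-X []      = ≋-refl
∘-X (a ∷ p) = ≋-trans (+ₚ-cong (≋-refl {constₚ a}) (*ₚ-congˡ Xₚ (∘-X p))) (≋-sym (∷-decompose a p))

-- `iterₚ` puts the new f on the outside, whereas the irreducibility step passes from P to P(f),
-- with f on the inside.
iter-suc : ∀ f n → iterₚ f (suc n) ≋ iterₚ f n ∘ₚ f
iter-suc f zero    = ≋-trans (∘-X f) (≋-sym (X-∘ f))
iter-suc f (suc n) = ≋-trans (∘-congˡ f (iter-suc f n)) (≋-sym (∘-assoc f (iterₚ f n) f))

irreducible-cong : ∀ {p q} → p ≋ q → Irreducible p → Irreducible q
irreducible-cong {p} {q} e (nc , irr) =
  (λ c → nc (degLt-cong 1 (≋-sym e) c)) , λ g h q≈gh → irr g h λ i → trans (at e i) (q≈gh i)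

Monic : Poly → ℕ → Set
Monic p n = DegLt p (suc n) × coeff p n ≡ 1ℚ

monic-cong : ∀ {p q} n → p ≋ q → Monic p n → Monic q n
monic-cong n e (d , l) = degLt-cong (suc n) e d , trans (sym (at e n)) l

monic⇒hasDeg : ∀ p n → Monic p n → HasDeg p n
monic⇒hasDeg p n (d , l) = d , λ z → 1≢0 (trans (sym l) z)

monic-*+small : ∀ p q m n r → Monic p m → Monic q n → DegLt r (m ℕ.+ n) → Monic ((p *ₚ q) +ₚ r) (m ℕ.+ n)
monic-*+small p q m n r (dp , lp) (dq , lq) dr =
  degLt-+ (p *ₚ q) r _ (degLt-* p q m n dp dq) (degLt-mono r (ℕP.n≤1+n _) dr) ,
  trans (coeff-+ (p *ₚ q) r (m ℕ.+ n))
    (cong₂ _+_ (trans (coeff-*-top p q m n dp dq) (cong₂ _*_ lp lq)) (dr (m ℕ.+ n) ℕP.≤-refl))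

-- Norms from ℚ[x] to ℚ[f]

sq≡0⇒≡0 : ∀ x → x * x ≡ 0ℚ → x ≡ 0ℚ
sq≡0⇒≡0 x xx≡0 with x ℚP.≟ 0ℚ
... | yes x≡0 = x≡0
... | no  x≢0 = ℚ-integral x x xx≡0 x≢0

degLt-length : ∀ p → DegLt p (length p)
degLt-length []      i       _         = refl
degLt-length (a ∷ p) (suc i) (s≤s l≤i) = degLt-length p i l≤i

-- z and w are variables, and not defined as these lists, so that products with them do not unfold.
module Quadratic (γ κ : ℚ) (f z w : Poly) (z-shape : z ≋ - γ ∷ 1ℚ ∷ []) (w-shape : w ≋ - κ ∷ 1ℚ ∷ []) where

  norm : Poly → Poly → Poly
  norm A B = (A *ₚ A) +ₚ negₚ (w *ₚ (B *ₚ B))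

  private
    linear-monic : ∀ {p} a → p ≋ a ∷ 1ℚ ∷ [] → Monic p 1
    linear-monic a e = monic-cong 1 (≋-sym e) ((λ { (suc (suc i)) _ → refl ; (suc zero) (s≤s ()) }) , refl)

    w-monic : Monic w 1
    w-monic = linear-monic (- κ) w-shape

    eval-w : eval w κ ≡ 0ℚ
    eval-w = trans (Eval.eval-cong κ w (- κ ∷ 1ℚ ∷ []) w-shape) (trans (cong (λ t → - κ + κ * t) (eval-const 1ℚ κ)) (trans (cong (λ t → - κ + t) (ℚP.*-identityʳ κ)) (ℚP.+-inverseˡ κ)))

  eval-norm : ∀ A B x → eval (norm A B) x ≡ eval A x * eval A x - eval w x * (eval B x * eval B x)
  eval-norm A B x = trans (Eval.eval-+ x (A *ₚ A) (negₚ (w *ₚ (B *ₚ B))))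
    (cong₂ _+_ (Eval.eval-* x A A) (trans (eval-neg (w *ₚ (B *ₚ B)) x)
      (cong -_ (trans (Eval.eval-* x w (B *ₚ B)) (cong (eval w x *_) (Eval.eval-* x B B))))))

  eval-norm-κ : ∀ A B → eval (norm A B) κ ≡ eval A κ * eval A κ
  eval-norm-κ A B = begin
    eval (norm A B) κ                                            ≡⟨ eval-norm A B κ ⟩
    eval A κ * eval A κ - eval w κ * (eval B κ * eval B κ)       ≡⟨ cong (λ t → eval A κ * eval A κ - t * (eval B κ * eval B κ)) eval-w ⟩
    eval A κ * eval A κ - 0ℚ * (eval B κ * eval B κ)             ≡⟨ cong (λ t → eval A κ * eval A κ - t) (ℚP.*-zeroˡ (eval B κ * eval B κ)) ⟩
    eval A κ * eval A κ + 0ℚ                                     ≡⟨ ℚP.+-identityʳ (eval A κ * eval A κ) ⟩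
    eval A κ * eval A κ                                          ∎
    where open ≡-Reasoning

  private
    degLt-wB² : ∀ B n → DegLt B n → DegLt (w *ₚ (B *ₚ B)) (n ℕ.+ n)
    degLt-wB² B zero    d = degLt-cong 0 (≋-sym (≋-trans (*ₚ-congˡ w (*ₚ-cong (degLt0⇒≋[] B d) (≋-refl {B}))) (*ₚ-zeroʳ w))) (λ _ _ → refl)
    degLt-wB² B (suc n) d = subst (DegLt (w *ₚ (B *ₚ B))) (cong suc (sym (ℕP.+-suc n n)))
      (degLt-* w (B *ₚ B) 1 (n ℕ.+ n) (proj₁ w-monic) (degLt-* B B n n d d))

    coeff-norm : ∀ A B i → coeff (norm A B) i ≡ coeff (A *ₚ A) i - coeff (w *ₚ (B *ₚ B)) i
    coeff-norm A B i = trans (coeff-+ (A *ₚ A) (negₚ (w *ₚ (B *ₚ B))) i)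
      (cong (λ t → coeff (A *ₚ A) i + t) (coeff-neg (w *ₚ (B *ₚ B)) i))

  -- For B of degree below e, the product w B² has degree at most 2 e - 1, so it does not reach the
  -- index 2 e.
  norm-top : ∀ A B e → DegLt A (suc e) → DegLt B e → coeff (norm A B) (e ℕ.+ e) ≡ coeff A e * coeff A e
  norm-top A B e dA dB = begin
    coeff (norm A B) (e ℕ.+ e)                                    ≡⟨ coeff-norm A B (e ℕ.+ e) ⟩
    coeff (A *ₚ A) (e ℕ.+ e) - coeff (w *ₚ (B *ₚ B)) (e ℕ.+ e)    ≡⟨ cong₂ _-_ (coeff-*-top A A e e dA dA) (degLt-wB² B e dB (e ℕ.+ e) ℕP.≤-refl) ⟩
    coeff A e * coeff A e + 0ℚ                                    ≡⟨ ℚP.+-identityʳ (coeff A e * coeff A e) ⟩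
    coeff A e * coeff A e                                         ∎
    where open ≡-Reasoning

  private
    -- The mirror case: here A² stops at the index 2 n, and w is monic of degree 1.
    norm-top-odd : ∀ A B n → DegLt A (suc n) → DegLt B (suc n) →
                   coeff (norm A B) (suc (n ℕ.+ n)) ≡ - (coeff B n * coeff B n)
    norm-top-odd A B n dA dB = begin
      coeff (norm A B) (suc (n ℕ.+ n))                                         ≡⟨ coeff-norm A B (suc (n ℕ.+ n)) ⟩
      coeff (A *ₚ A) (suc (n ℕ.+ n)) - coeff (w *ₚ (B *ₚ B)) (suc (n ℕ.+ n))   ≡⟨ cong₂ _-_ (degLt-* A A n n dA dA (suc (n ℕ.+ n)) ℕP.≤-refl) top ⟩
      0ℚ - coeff B n * coeff B n                                               ≡⟨ ℚP.+-identityˡ (- (coeff B n * coeff B n)) ⟩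
      - (coeff B n * coeff B n)                                                ∎
      where
      open ≡-Reasoning
      top : coeff (w *ₚ (B *ₚ B)) (suc (n ℕ.+ n)) ≡ coeff B n * coeff B n
      top = begin
        coeff (w *ₚ (B *ₚ B)) (suc (n ℕ.+ n))  ≡⟨ coeff-*-top w (B *ₚ B) 1 (n ℕ.+ n) (proj₁ w-monic) (degLt-* B B n n dB dB) ⟩
        coeff w 1 * coeff (B *ₚ B) (n ℕ.+ n)   ≡⟨ cong (_* coeff (B *ₚ B) (n ℕ.+ n)) (proj₂ w-monic) ⟩
        1ℚ * coeff (B *ₚ B) (n ℕ.+ n)          ≡⟨ ℚP.*-identityˡ (coeff (B *ₚ B) (n ℕ.+ n)) ⟩
        coeff (B *ₚ B) (n ℕ.+ n)               ≡⟨ coeff-*-top B B n n dB dB ⟩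
        coeff B n * coeff B n                  ∎

    -- A² has even degree and w B² odd degree, so no cancellation occurs: the bounds on the degrees
    -- of A and B can be lowered from k + e to e one coefficient at a time.
    norm-descent : ∀ A B e k → DegLt (norm A B) (suc (e ℕ.+ e)) → DegLt A (suc (k ℕ.+ e)) → DegLt B (k ℕ.+ e) →
                   DegLt A (suc e) × DegLt B e
    norm-descent A B e zero    dN dA dB = dA , dB
    norm-descent A B e (suc k) dN dA dB = norm-descent A B e k dN dA′ dB′
      where
      n = k ℕ.+ e
      e≤n : e ≤ n
      e≤n = ℕP.m≤n+m e k
      dA′ : DegLt A (suc n)
      dA′ = degLt-pred A (suc n) dA (sq≡0⇒≡0 (coeff A (suc n)) (trans (sym (norm-top A B (suc n) dA dB))
        (dN (suc n ℕ.+ suc n) (s≤s (ℕP.+-mono-≤ e≤n (ℕP.m≤n⇒m≤1+n e≤n))))))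
      -- The odd coefficient is free of A only after the bound on A has been lowered, hence the use
      -- of `dA′`.
      dB′ : DegLt B n
      dB′ = degLt-pred B n dB (sq≡0⇒≡0 (coeff B n) (ℚP.neg-injective (trans (sym (norm-top-odd A B n dA′ dB))
        (dN (suc (n ℕ.+ n)) (s≤s (ℕP.+-mono-≤ e≤n e≤n))))))

  norm-degLt : ∀ A B e → DegLt (norm A B) (suc (e ℕ.+ e)) → DegLt A (suc e) × DegLt B e
  -- The lengths of the two lists give a crude bound from which the descent starts.
  norm-degLt A B e dN = norm-descent A B e k dN
    (degLt-mono A (ℕP.≤-trans (ℕP.m≤m+n (length A) (length B)) (ℕP.≤-trans (ℕP.m≤m+n k e) (ℕP.n≤1+n _))) (degLt-length A))
    (degLt-mono B (ℕP.≤-trans (ℕP.m≤n+m (length B) (length A)) (ℕP.m≤m+n k e)) (degLt-length B))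
    where k = length A ℕ.+ length B

  -- Over a root of P, an associate of P being a norm says that w is a square.
  norm-associate : ∀ P e → Monic P (e ℕ.+ e) → ∀ A B u → norm A B ≋ constₚ u *ₚ P →
    DegLt A (suc e) × DegLt B e × u ≡ coeff A e * coeff A e
  norm-associate P e (dP , lP) A B u N≋uP = proj₁ dAB , proj₂ dAB , (begin
      u                                    ≡⟨ ℚP.*-identityʳ u ⟨
      u * 1ℚ                               ≡⟨ cong (u *_) lP ⟨
      u * coeff P (e ℕ.+ e)                ≡⟨ coeff-scale u P (e ℕ.+ e) ⟨
      coeff (scaleₚ u P) (e ℕ.+ e)         ≡⟨ at (≋-trans N≋uP (constₚ-*ₚ u P)) (e ℕ.+ e) ⟨
      coeff (norm A B) (e ℕ.+ e)           ≡⟨ norm-top A B e (proj₁ dAB) (proj₂ dAB) ⟩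
      coeff A e * coeff A e                ∎)
    where
    open ≡-Reasoning
    dAB : DegLt A (suc e) × DegLt B e
    dAB = norm-degLt A B e (degLt-cong (suc (e ℕ.+ e)) (≋-sym (≋-trans N≋uP (constₚ-*ₚ u P)))
            (degLt-scale u P (suc (e ℕ.+ e)) dP))

  module _ (f-shape : f ≋ (z *ₚ z) +ₚ constₚ κ) where

    private
      f-monic : Monic f 2
      f-monic = monic-cong 2 (≋-sym f-shape) (monic-*+small z z 1 1 (constₚ κ) (linear-monic (- γ) z-shape) (linear-monic (- γ) z-shape) λ { (suc i) _ → refl })

      w∘f : w ∘ₚ f ≋ z *ₚ z
      w∘f = begin
        w ∘ₚ f                                        ≈⟨ ≋-trans (Comp.∘-congʳ f w (- κ ∷ 1ℚ ∷ []) w-shape) (linear-∘ (- κ) f) ⟩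
        f +ₚ constₚ (- κ)                             ≈⟨ +ₚ-cong f-shape (constₚ-neg κ) ⟩
        ((z *ₚ z) +ₚ constₚ κ) +ₚ negₚ (constₚ κ)     ≈⟨ solveₚ 2 (λ s k → s ⊞ k ⊟ k ⊜ s) (z *ₚ z) (constₚ κ) ⟩
        z *ₚ z                                        ∎
        where open ≋-Reasoning

      X-shift : Xₚ ≋ z +ₚ constₚ γ
      X-shift = ≋-trans (∷-cong (sym (ℚP.+-inverseˡ γ)) ≋-refl) (+ₚ-cong (≋-sym z-shape) (≋-refl {constₚ γ}))

    -- The form A(f) + z B(f) survives multiplication by x = z + γ because z² = w(f); Horner
    -- recursion on the coefficients does the rest.
    decompose : ∀ h → ∃₂ λ A B → h ≋ (A ∘ₚ f) +ₚ (z *ₚ (B ∘ₚ f))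
    decompose []      = [] , [] , ≋-sym (*ₚ-zeroʳ z)
    decompose (a ∷ h) with U , V , e ← decompose h =
      (constₚ a +ₚ (constₚ γ *ₚ U)) +ₚ (w *ₚ V) , U +ₚ (constₚ γ *ₚ V) , (begin
        a ∷ h                                                   ≈⟨ ∷-decompose a h ⟩
        constₚ a +ₚ (Xₚ *ₚ h)                                   ≈⟨ +ₚ-cong (≋-refl {constₚ a}) (*ₚ-cong X-shift e) ⟩
        constₚ a +ₚ ((z +ₚ constₚ γ) *ₚ ((U ∘ₚ f) +ₚ (z *ₚ (V ∘ₚ f))))
          ≈⟨ solveₚ 5 (λ a z g U V → a ⊞ (z ⊞ g) ⊠ (U ⊞ z ⊠ V) ⊜ (a ⊞ g ⊠ U ⊞ (z ⊠ z) ⊠ V) ⊞ z ⊠ (U ⊞ g ⊠ V)) (constₚ a) z (constₚ γ) (U ∘ₚ f) (V ∘ₚ f) ⟩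
        ((constₚ a +ₚ (constₚ γ *ₚ (U ∘ₚ f))) +ₚ ((z *ₚ z) *ₚ (V ∘ₚ f))) +ₚ (z *ₚ ((U ∘ₚ f) +ₚ (constₚ γ *ₚ (V ∘ₚ f))))
          ≈⟨ +ₚ-cong (≋-sym (A∘f U V)) (*ₚ-congˡ z (≋-sym (B∘f U V))) ⟩
        (((constₚ a +ₚ (constₚ γ *ₚ U)) +ₚ (w *ₚ V)) ∘ₚ f) +ₚ (z *ₚ ((U +ₚ (constₚ γ *ₚ V)) ∘ₚ f)) ∎)
      where
      open ≋-Reasoning
      open Comp f
      γ*∘f : ∀ U → (constₚ γ *ₚ U) ∘ₚ f ≋ constₚ γ *ₚ (U ∘ₚ f)
      γ*∘f U = ≋-trans (∘-* (constₚ γ) U) (*ₚ-cong (const-∘ γ f) (≋-refl {U ∘ₚ f}))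
      A∘f : ∀ U V → ((constₚ a +ₚ (constₚ γ *ₚ U)) +ₚ (w *ₚ V)) ∘ₚ f
              ≋ (constₚ a +ₚ (constₚ γ *ₚ (U ∘ₚ f))) +ₚ ((z *ₚ z) *ₚ (V ∘ₚ f))
      A∘f U V = ≋-trans (∘-+ (constₚ a +ₚ (constₚ γ *ₚ U)) (w *ₚ V))
        (+ₚ-cong (≋-trans (∘-+ (constₚ a) (constₚ γ *ₚ U)) (+ₚ-cong (const-∘ a f) (γ*∘f U)))
                 (≋-trans (∘-* w V) (*ₚ-cong w∘f (≋-refl {V ∘ₚ f}))))
      B∘f : ∀ U V → (U +ₚ (constₚ γ *ₚ V)) ∘ₚ f ≋ (U ∘ₚ f) +ₚ (constₚ γ *ₚ (V ∘ₚ f))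
      B∘f U V = ≋-trans (∘-+ U (constₚ γ *ₚ V)) (+ₚ-cong (≋-refl {U ∘ₚ f}) (γ*∘f V))

    private
      -- Unless Q vanishes, f Q has degree at least 2, and `L` cannot cancel its leading term.
      small+f*Q : ∀ L Q → DegLt L 2 → L +ₚ (f *ₚ Q) ≋ [] → Q ≋ []
      small+f*Q L Q dL e = [ (λ Q≋[] → Q≋[]) , (λ { (n , hQ) → ⊥-elim (absurd n hQ) }) ]′ (zeroOrHasDeg Q)
        where
        absurd : ∀ n → HasDeg Q n → ⊥
        absurd n hQ = proj₂ (hasDeg-* f Q 2 n (monic⇒hasDeg f 2 f-monic) hQ) (begin
          coeff (f *ₚ Q) (2 ℕ.+ n)                        ≡⟨ ℚP.+-identityˡ (coeff (f *ₚ Q) (2 ℕ.+ n)) ⟨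
          0ℚ + coeff (f *ₚ Q) (2 ℕ.+ n)                   ≡⟨ cong (_+ coeff (f *ₚ Q) (2 ℕ.+ n)) (dL (2 ℕ.+ n) (ℕP.m≤m+n 2 n)) ⟨
          coeff L (2 ℕ.+ n) + coeff (f *ₚ Q) (2 ℕ.+ n)    ≡⟨ coeff-+ L (f *ₚ Q) (2 ℕ.+ n) ⟨
          coeff (L +ₚ (f *ₚ Q)) (2 ℕ.+ n)                 ≡⟨ at e (2 ℕ.+ n) ⟩
          0ℚ                                              ∎)
          where open ≡-Reasoning

      decompose-step : ∀ u v U V → (constₚ u +ₚ (f *ₚ U)) +ₚ (z *ₚ (constₚ v +ₚ (f *ₚ V))) ≋ [] →
                       u ≡ 0ℚ × v ≡ 0ℚ × U +ₚ (z *ₚ V) ≋ []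
      decompose-step u v U V e = u≡0 , v≡0 , Q≋[]
        where
        L Q : Poly
        -- `L` is u + z v expanded with z = x - γ, so that its degree bound holds by computation.
        L = (u + - γ * v) ∷ v ∷ []
        Q = U +ₚ (z *ₚ V)
        L-shape : L ≋ constₚ u +ₚ (z *ₚ constₚ v)
        L-shape = ≋-trans (∷-cong (cong (λ t → u + t) (sym (ℚP.+-identityʳ (- γ * v))))
                    (∷-cong (sym (trans (ℚP.+-identityʳ (1ℚ * v)) (ℚP.*-identityˡ v))) ≋-refl))
                    (+ₚ-cong (≋-refl {constₚ u}) (*ₚ-cong (≋-sym z-shape) (≋-refl {constₚ v})))
        L+fQ : L +ₚ (f *ₚ Q) ≋ []
        L+fQ = begin
          L +ₚ (f *ₚ Q)                                          ≈⟨ +ₚ-cong L-shape (≋-refl {f *ₚ Q}) ⟩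
          (constₚ u +ₚ (z *ₚ constₚ v)) +ₚ (f *ₚ Q)
            ≈⟨ solveₚ 6 (λ u z v f U V → (u ⊞ z ⊠ v) ⊞ f ⊠ (U ⊞ z ⊠ V) ⊜ (u ⊞ f ⊠ U) ⊞ z ⊠ (v ⊞ f ⊠ V)) (constₚ u) z (constₚ v) f U V ⟩
          (constₚ u +ₚ (f *ₚ U)) +ₚ (z *ₚ (constₚ v +ₚ (f *ₚ V))) ≈⟨ e ⟩
          []                                                     ∎
          where open ≋-Reasoning
        Q≋[] : Q ≋ []
        Q≋[] = small+f*Q L Q (λ { (suc (suc i)) _ → refl ; (suc zero) (s≤s ()) }) L+fQ
        L≋[] : L ≋ []
        L≋[] = begin
          L                ≈⟨ +ₚ-identityʳ L ⟨
          L +ₚ []          ≈⟨ +ₚ-cong (≋-refl {L}) (≋-trans (*ₚ-congˡ f Q≋[]) (*ₚ-zeroʳ f)) ⟨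
          L +ₚ (f *ₚ Q)    ≈⟨ L+fQ ⟩
          []               ∎
          where open ≋-Reasoning
        v≡0 : v ≡ 0ℚ
        v≡0 = at L≋[] 1
        u≡0 : u ≡ 0ℚ
        u≡0 = begin
          u               ≡⟨ ℚP.+-identityʳ u ⟨
          u + 0ℚ          ≡⟨ cong (λ t → u + t) (ℚP.*-zeroʳ (- γ)) ⟨
          u + - γ * 0ℚ    ≡⟨ cong (λ t → u + - γ * t) v≡0 ⟨
          u + - γ * v     ≡⟨ at L≋[] 0 ⟩
          0ℚ              ∎
          where open ≡-Reasoning

      -- Lets an exhausted list count as one whose next coefficient is 0, so that `decompose-step`
      -- also covers lists of unequal length.
      0+f*[] : [] ≋ constₚ 0ℚ +ₚ (f *ₚ [])
      0+f*[] = ≋-sym (≋-trans (+ₚ-cong 0∷[] (*ₚ-zeroʳ f)) ≋-refl)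

    -- Modulo f only u + z v survives, and 1 and z are independent in degree below 2. Division by f
    -- then exposes the next pair of coefficients.
    decompose-unique : ∀ U V → (U ∘ₚ f) +ₚ (z *ₚ (V ∘ₚ f)) ≋ [] → U ≋ [] × V ≋ []
    decompose-unique []      []      e = ≋-refl , ≋-refl
    decompose-unique (u ∷ U) []      e =
      ≋-trans (∷-cong (proj₁ step) (proj₁ (decompose-unique U [] (proj₂ (proj₂ step))))) 0∷[] , ≋-refl
      where
      step : u ≡ 0ℚ × 0ℚ ≡ 0ℚ × (U ∘ₚ f) +ₚ (z *ₚ []) ≋ []
      step = decompose-step u 0ℚ (U ∘ₚ f) []
        (≋-trans (+ₚ-cong (≋-refl {constₚ u +ₚ (f *ₚ (U ∘ₚ f))}) (*ₚ-congˡ z (≋-sym 0+f*[]))) e)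
    decompose-unique []      (v ∷ V) e =
      ≋-refl , ≋-trans (∷-cong (proj₁ (proj₂ step)) (proj₂ (decompose-unique [] V (proj₂ (proj₂ step))))) 0∷[]
      where
      step : 0ℚ ≡ 0ℚ × v ≡ 0ℚ × z *ₚ (V ∘ₚ f) ≋ []
      step = decompose-step 0ℚ v [] (V ∘ₚ f)
        (≋-trans (+ₚ-cong (≋-sym 0+f*[]) (≋-refl {z *ₚ (constₚ v +ₚ (f *ₚ (V ∘ₚ f)))})) e)
    decompose-unique (u ∷ U) (v ∷ V) e =
      ≋-trans (∷-cong (proj₁ step) (proj₁ tails)) 0∷[] ,
      ≋-trans (∷-cong (proj₁ (proj₂ step)) (proj₂ tails)) 0∷[]
      where
      step : u ≡ 0ℚ × v ≡ 0ℚ × (U ∘ₚ f) +ₚ (z *ₚ (V ∘ₚ f)) ≋ []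
      step = decompose-step u v (U ∘ₚ f) (V ∘ₚ f) e
      tails : U ≋ [] × V ≋ []
      tails = decompose-unique U V (proj₂ (proj₂ step))

    -- The product of the two factors is S(f) + z R(f). Uniqueness of the decomposition forces S = P
    -- and R = 0, and the norm of S + R √w is the product of the two norms.
    norm-factors : ∀ P A B C D →
      P ∘ₚ f ≋ ((A ∘ₚ f) +ₚ (z *ₚ (B ∘ₚ f))) *ₚ ((C ∘ₚ f) +ₚ (z *ₚ (D ∘ₚ f))) →
      norm A B *ₚ norm C D ≋ P *ₚ P
    norm-factors P A B C D e = begin
      norm A B *ₚ norm C D
        ≈⟨ solveₚ 5 (λ A B C D w → (A ⊠ A ⊟ w ⊠ (B ⊠ B)) ⊠ (C ⊠ C ⊟ w ⊠ (D ⊠ D)) ⊜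
             (A ⊠ C ⊞ w ⊠ (B ⊠ D)) ⊠ (A ⊠ C ⊞ w ⊠ (B ⊠ D)) ⊟ w ⊠ ((A ⊠ D ⊞ B ⊠ C) ⊠ (A ⊠ D ⊞ B ⊠ C))) A B C D w ⟩
      (S *ₚ S) +ₚ negₚ (w *ₚ (R *ₚ R))
        ≈⟨ +ₚ-cong (*ₚ-cong S≋P S≋P) (negₚ-cong (*ₚ-congˡ w (*ₚ-cong R≋[] (≋-refl {R})))) ⟩
      (P *ₚ P) +ₚ negₚ (w *ₚ [])
        ≈⟨ +ₚ-cong (≋-refl {P *ₚ P}) (negₚ-cong (*ₚ-zeroʳ w)) ⟩
      (P *ₚ P) +ₚ [] ≈⟨ +ₚ-identityʳ (P *ₚ P) ⟩
      P *ₚ P ∎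
      where
      open ≋-Reasoning
      open Comp f
      S R : Poly
      S = (A *ₚ C) +ₚ (w *ₚ (B *ₚ D))
      R = (A *ₚ D) +ₚ (B *ₚ C)
      S∘f : S ∘ₚ f ≋ ((A ∘ₚ f) *ₚ (C ∘ₚ f)) +ₚ ((z *ₚ z) *ₚ ((B ∘ₚ f) *ₚ (D ∘ₚ f)))
      S∘f = ≋-trans (∘-+ (A *ₚ C) (w *ₚ (B *ₚ D)))
        (+ₚ-cong (∘-* A C) (≋-trans (∘-* w (B *ₚ D)) (*ₚ-cong w∘f (∘-* B D))))
      R∘f : R ∘ₚ f ≋ ((A ∘ₚ f) *ₚ (D ∘ₚ f)) +ₚ ((B ∘ₚ f) *ₚ (C ∘ₚ f))
      R∘f = ≋-trans (∘-+ (A *ₚ D) (B *ₚ C)) (+ₚ-cong (∘-* A D) (∘-* B C))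
      zero-decomposition : ((S +ₚ negₚ P) ∘ₚ f) +ₚ (z *ₚ (R ∘ₚ f)) ≋ []
      zero-decomposition = begin
        ((S +ₚ negₚ P) ∘ₚ f) +ₚ (z *ₚ (R ∘ₚ f))
          ≈⟨ +ₚ-cong (≋-trans (∘-+ S (negₚ P)) (+ₚ-cong S∘f (≋-trans (∘-scale (- 1ℚ) P) (constₚ-*ₚ (- 1ℚ) (P ∘ₚ f))))) (*ₚ-congˡ z R∘f) ⟩
        ((((A ∘ₚ f) *ₚ (C ∘ₚ f)) +ₚ ((z *ₚ z) *ₚ ((B ∘ₚ f) *ₚ (D ∘ₚ f)))) +ₚ negₚ (P ∘ₚ f))
          +ₚ (z *ₚ (((A ∘ₚ f) *ₚ (D ∘ₚ f)) +ₚ ((B ∘ₚ f) *ₚ (C ∘ₚ f))))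
          ≈⟨ solveₚ 6 (λ A B C D z p → (A ⊠ C ⊞ (z ⊠ z) ⊠ (B ⊠ D) ⊟ p) ⊞ z ⊠ (A ⊠ D ⊞ B ⊠ C) ⊜
               (A ⊞ z ⊠ B) ⊠ (C ⊞ z ⊠ D) ⊟ p) (A ∘ₚ f) (B ∘ₚ f) (C ∘ₚ f) (D ∘ₚ f) z (P ∘ₚ f) ⟩
        (((A ∘ₚ f) +ₚ (z *ₚ (B ∘ₚ f))) *ₚ ((C ∘ₚ f) +ₚ (z *ₚ (D ∘ₚ f)))) +ₚ negₚ (P ∘ₚ f)
          ≈⟨ +ₚ-cong (≋-sym e) (≋-refl {negₚ (P ∘ₚ f)}) ⟩
        (P ∘ₚ f) +ₚ negₚ (P ∘ₚ f)
          ≈⟨ +ₚ-inverseʳ (P ∘ₚ f) ⟩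
        [] ∎
      R≋[] : R ≋ []
      R≋[] = proj₂ (decompose-unique (S +ₚ negₚ P) R zero-decomposition)
      S≋P : S ≋ P
      S≋P = begin
        S                   ≈⟨ solveₚ 2 (λ s p → s ⊜ (s ⊟ p) ⊞ p) S P ⟩
        (S +ₚ negₚ P) +ₚ P  ≈⟨ +ₚ-cong (proj₁ (decompose-unique (S +ₚ negₚ P) R zero-decomposition)) (≋-refl {P}) ⟩
        P                   ∎

    private
      -- At e = 0 the degree bound for norms leaves A constant and B zero.
      norm-const⇒const : ∀ A B → IsConst (norm A B) → IsConst ((A ∘ₚ f) +ₚ (z *ₚ (B ∘ₚ f)))
      norm-const⇒const A B cN = degLt-cong 1 (≋-sym (begin
          (A ∘ₚ f) +ₚ (z *ₚ (B ∘ₚ f))               ≈⟨ +ₚ-cong (Comp.∘-congʳ f A (constₚ a) (const-≋ A (proj₁ dAB))) (*ₚ-congˡ z (Comp.∘-zero f B (degLt0⇒≋[] B (proj₂ dAB)))) ⟩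
          (constₚ a ∘ₚ f) +ₚ (z *ₚ [])              ≈⟨ +ₚ-cong (const-∘ a f) (*ₚ-zeroʳ z) ⟩
          constₚ a +ₚ []                            ≈⟨ +ₚ-identityʳ (constₚ a) ⟩
          constₚ a                                  ∎)) λ { (suc i) _ → refl }
        where
        open ≋-Reasoning
        a = coeff A 0
        dAB : DegLt A 1 × DegLt B 0
        dAB = norm-degLt A B 0 cN

    -- Capelli's lemma in norm form. The equation has to be excluded for u ≠ 0 alone, since a norm
    -- with u = 0 among the two factors would make P² vanish.
    ∘-irreducible : ∀ P → Irreducible P → ¬ IsConst (P ∘ₚ f) →
      (∀ A B u → u ≢ 0ℚ → ¬ norm A B ≋ constₚ u *ₚ P) → Irreducible (P ∘ₚ f)
    ∘-irreducible P irr nc noNorm = nc , factor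
      where
      factor : ∀ h k → (P ∘ₚ f) ≈ₚ (h *ₚ k) → IsConst h ⊎ IsConst k
      factor h k e = split (decompose h) (decompose k)
        where
        u≢0 : ∀ H K u → H *ₚ K ≋ P *ₚ P → H ≋ constₚ u *ₚ P → u ≢ 0ℚ
        u≢0 H K u HK≋PP H≋uP u≡0 = irreducible⇒≉[] P irr
          (*ₚ-integral P P (≋-trans (≋-sym HK≋PP) (*ₚ-cong H≋[] (≋-refl {K}))) (irreducible⇒≉[] P irr))
          where
          H≋[] : H ≋ []
          H≋[] = ≋-trans H≋uP (≋-trans (constₚ-*ₚ u P) (≋-trans (scale-cong u≡0 (≋-refl {P})) (scale-zero P)))
        split : (∃₂ λ A B → h ≋ (A ∘ₚ f) +ₚ (z *ₚ (B ∘ₚ f))) → (∃₂ λ C D → k ≋ (C ∘ₚ f) +ₚ (z *ₚ (D ∘ₚ f))) →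
                IsConst h ⊎ IsConst k
        split (A , B , h≋) (C , D , k≋) =
          [ [ (λ c → inj₁ (degLt-cong 1 (≋-sym h≋) (norm-const⇒const A B c)))
            , (λ c → inj₂ (degLt-cong 1 (≋-sym k≋) (norm-const⇒const C D c))) ]′
          , [ (λ { (u , N≋uP) → ⊥-elim (noNorm A B u (u≢0 (norm A B) (norm C D) u NN≋PP N≋uP) N≋uP) })
            , (λ { (u , N≋uP) → ⊥-elim (noNorm C D u (u≢0 (norm C D) (norm A B) u (≋-trans (*ₚ-comm (norm C D) (norm A B)) NN≋PP) N≋uP) N≋uP) }) ]′
          ]′ (irreducible-square-factors P irr (norm A B) (norm C D) NN≋PP)
          where
          NN≋PP : norm A B *ₚ norm C D ≋ P *ₚ P
          NN≋PP = norm-factors P A B C D (≋-trans (coeffwise e) (*ₚ-cong h≋ k≋))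

-- Integers inside ℚ and nonsquares

toℚᵘ-ℤtoℚ : ∀ k → toℚᵘ (ℤtoℚ k) ≃ mkℚᵘ k 0
toℚᵘ-ℤtoℚ k = ℚP.toℚᵘ-fromℚᵘ (mkℚᵘ k 0)

ℤtoℚ-+ : ∀ i j → ℤtoℚ (i ℤ.+ j) ≡ ℤtoℚ i + ℤtoℚ j
ℤtoℚ-+ i j = ℚP.toℚᵘ-injective (ℚᵘP.≃-trans (toℚᵘ-ℤtoℚ (i ℤ.+ j)) (ℚᵘP.≃-sym
  (ℚᵘP.≃-trans (ℚP.toℚᵘ-homo-+ (ℤtoℚ i) (ℤtoℚ j)) (ℚᵘP.≃-trans (ℚᵘP.+-cong (toℚᵘ-ℤtoℚ i) (toℚᵘ-ℤtoℚ j))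
    (*≡* (cong (ℤ._* + 1) (cong₂ ℤ._+_ (ℤP.*-identityʳ i) (ℤP.*-identityʳ j))))))))

ℤtoℚ-* : ∀ i j → ℤtoℚ (i ℤ.* j) ≡ ℤtoℚ i * ℤtoℚ j
ℤtoℚ-* i j = ℚP.toℚᵘ-injective (ℚᵘP.≃-trans (toℚᵘ-ℤtoℚ (i ℤ.* j)) (ℚᵘP.≃-sym
  (ℚᵘP.≃-trans (ℚP.toℚᵘ-homo-* (ℤtoℚ i) (ℤtoℚ j)) (ℚᵘP.≃-trans (ℚᵘP.*-cong (toℚᵘ-ℤtoℚ i) (toℚᵘ-ℤtoℚ j))
    (*≡* refl)))))

ℤtoℚ-neg : ∀ i → ℤtoℚ (ℤ.- i) ≡ - ℤtoℚ i
ℤtoℚ-neg i = ℚP.toℚᵘ-injective (ℚᵘP.≃-trans (toℚᵘ-ℤtoℚ (ℤ.- i)) (ℚᵘP.≃-sym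
  (ℚᵘP.≃-trans (ℚP.toℚᵘ-homo‿- (ℤtoℚ i)) (ℚᵘP.-‿cong (toℚᵘ-ℤtoℚ i)))))

ℤtoℚ-∣∣ : ∀ i → ℤtoℚ (+ ℤ.∣ i ∣) ≡ ∣ ℤtoℚ i ∣
ℤtoℚ-∣∣ i = ℚP.toℚᵘ-injective (ℚᵘP.≃-trans (toℚᵘ-ℤtoℚ (+ ℤ.∣ i ∣)) (ℚᵘP.≃-sym
  (ℚᵘP.≃-trans (ℚP.toℚᵘ-homo-∣-∣ (ℤtoℚ i)) (ℚᵘP.∣-∣-cong (toℚᵘ-ℤtoℚ i)))))

ℤtoℚ-injective : ∀ i j → ℤtoℚ i ≡ ℤtoℚ j → i ≡ j
ℤtoℚ-injective i j e with *≡* e′ ← ℚᵘP.≃-trans (ℚᵘP.≃-sym (toℚᵘ-ℤtoℚ i)) (ℚᵘP.≃-trans (ℚᵘP.≃-reflexive (cong toℚᵘ e)) (toℚᵘ-ℤtoℚ j)) =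
  trans (sym (ℤP.*-identityʳ i)) (trans e′ (ℤP.*-identityʳ j))

ℤtoℚ-cancel-< : ∀ i j → ℤtoℚ i < ℤtoℚ j → i ℤ.< j
ℤtoℚ-cancel-< i j i<j
  with *<* lt ← ℚᵘP.<-respʳ-≃ (toℚᵘ-ℤtoℚ j) (ℚᵘP.<-respˡ-≃ (toℚᵘ-ℤtoℚ i) (ℚP.toℚᵘ-mono-< i<j))
  = subst₂ ℤ._<_ (ℤP.*-identityʳ i) (ℤP.*-identityʳ j) lt

ℕtoℚ : ℕ → ℚ
ℕtoℚ n = ℤtoℚ (+ n)

ℕtoℚ-+ : ∀ m n → ℕtoℚ (m ℕ.+ n) ≡ ℕtoℚ m + ℕtoℚ n
ℕtoℚ-+ m n = trans (cong ℤtoℚ (ℤP.pos-+ m n)) (ℤtoℚ-+ (+ m) (+ n))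

ℕtoℚ-* : ∀ m n → ℕtoℚ (m ℕ.* n) ≡ ℕtoℚ m * ℕtoℚ n
ℕtoℚ-* m n = trans (cong ℤtoℚ (ℤP.pos-* m n)) (ℤtoℚ-* (+ m) (+ n))

ℕtoℚ-cancel-< : ∀ m n → ℕtoℚ m < ℕtoℚ n → m ℕ.< n
ℕtoℚ-cancel-< m n m<n = ℤP.drop‿+<+ (ℤtoℚ-cancel-< (+ m) (+ n) m<n)

-- In lowest terms p / d the equation reads p² = N d². Then d divides p², hence p by coprimality,
-- hence d = 1.
ℚ-square-integral : ∀ s N → s * s ≡ ℤtoℚ N → ∃ λ Y → Y ℤ.* Y ≡ N
ℚ-square-integral s@(mkℚ p d-1 c) N e
  with *≡* e′ ← ℚᵘP.≃-trans (ℚᵘP.≃-sym (ℚP.toℚᵘ-homo-* s s)) (ℚᵘP.≃-trans (ℚᵘP.≃-reflexive (cong toℚᵘ e)) (toℚᵘ-ℤtoℚ N)) =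
  p , (begin
    p ℤ.* p                      ≡⟨ pp≡Ndd ⟩
    N ℤ.* (+ d ℤ.* + d)          ≡⟨ cong (λ t → N ℤ.* (+ t ℤ.* + t)) d≡1 ⟩
    N ℤ.* + 1                    ≡⟨ ℤP.*-identityʳ N ⟩
    N                            ∎)
  where
  open ≡-Reasoning
  d = suc d-1
  pp≡Ndd : p ℤ.* p ≡ N ℤ.* (+ d ℤ.* + d)
  pp≡Ndd = trans (sym (ℤP.*-identityʳ (p ℤ.* p))) e′
  d∣pp : d ℕD.∣ ℤ.∣ p ∣ ℕ.* ℤ.∣ p ∣
  d∣pp = ℕD.divides (ℤ.∣ N ∣ ℕ.* d) (begin
    ℤ.∣ p ∣ ℕ.* ℤ.∣ p ∣                ≡⟨ ℤP.abs-* p p ⟨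
    ℤ.∣ p ℤ.* p ∣                      ≡⟨ cong ℤ.∣_∣ pp≡Ndd ⟩
    ℤ.∣ N ℤ.* (+ d ℤ.* + d) ∣          ≡⟨ ℤP.abs-* N (+ d ℤ.* + d) ⟩
    ℤ.∣ N ∣ ℕ.* (d ℕ.* d)              ≡⟨ ℕP.*-assoc ℤ.∣ N ∣ d d ⟨
    ℤ.∣ N ∣ ℕ.* d ℕ.* d                ∎)
  coprime : Coprimality.Coprime ℤ.∣ p ∣ d
  -- A rational stores its coprimality proof irrelevantly; decidability recovers a usable one.
  coprime = Coprimality.recompute c
  d≡1 : d ≡ 1
  d≡1 = coprime (Coprimality.coprime-divisor (Coprimality.sym coprime) d∣pp , ℕD.∣-refl)

private
  -- The next square after a² is 2 a + 1 away, out of reach of τ.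
  square-above : ∀ a τ y → y ℕ.* y ≡ a ℕ.* a ℕ.+ τ → τ ℕ.+ 2 ≤ 2 ℕ.* a → τ ≡ 0
  square-above a τ y e τ+2≤2a with ℕP.≤-<-connex y a
  ... | inj₁ y≤a = ℕP.n≤0⇒n≡0 (ℕP.+-cancelˡ-≤ (a ℕ.* a) τ 0
        (ℕP.≤-trans (ℕP.≤-reflexive (sym e)) (ℕP.≤-trans (ℕP.*-mono-≤ y≤a y≤a) (ℕP.m≤m+n (a ℕ.* a) 0))))
  ... | inj₂ a<y = ⊥-elim (ℕP.n≮n (a ℕ.* a ℕ.+ τ) (begin-strict
      a ℕ.* a ℕ.+ τ              <⟨ ℕP.+-monoʳ-< (a ℕ.* a) (ℕP.≤-trans (ℕP.m<m+n τ (s≤s z≤n)) (ℕP.≤-trans τ+2≤2a (ℕP.n≤1+n (2 ℕ.* a)))) ⟩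
      a ℕ.* a ℕ.+ suc (2 ℕ.* a)  ≡⟨ ℕS.solve 1 (λ a → a :* a :+ (con 1 :+ con 2 :* a) := (con 1 :+ a) :* (con 1 :+ a)) refl a ⟩
      suc a ℕ.* suc a            ≤⟨ ℕP.*-mono-≤ a<y a<y ⟩
      y ℕ.* y                    ≡⟨ e ⟩
      a ℕ.* a ℕ.+ τ              ∎))
    where
    open ℕP.≤-Reasoning
    open ℕS using (_:+_; _:*_; _:=_; con)

  -- The square before a² is only 2 a - 1 away. This narrower side dictates the form τ + 2 ≤ 2 a of
  -- the bound.
  square-below : ∀ a τ y → y ℕ.* y ℕ.+ τ ≡ a ℕ.* a → τ ℕ.+ 2 ≤ 2 ℕ.* a → τ ≡ 0
  square-below a τ y e τ+2≤2a with ℕP.≤-<-connex a y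
  ... | inj₁ a≤y = ℕP.n≤0⇒n≡0 (ℕP.+-cancelˡ-≤ (y ℕ.* y) τ 0
        (ℕP.≤-trans (ℕP.≤-reflexive e) (ℕP.≤-trans (ℕP.*-mono-≤ a≤y a≤y) (ℕP.m≤m+n (y ℕ.* y) 0))))
  ... | inj₂ y<a with k , refl ← ℕP.m≤n⇒∃[o]m+o≡n y<a = ⊥-elim (ℕP.n≮n (y ℕ.* y ℕ.+ (τ ℕ.+ 2)) (begin-strict
      y ℕ.* y ℕ.+ (τ ℕ.+ 2)                     ≤⟨ ℕP.+-monoʳ-≤ (y ℕ.* y) τ+2≤2a ⟩
      y ℕ.* y ℕ.+ 2 ℕ.* (suc y ℕ.+ k)           <⟨ ℕP.m<m+n _ (s≤s z≤n) ⟩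
      y ℕ.* y ℕ.+ 2 ℕ.* (suc y ℕ.+ k) ℕ.+ suc (2 ℕ.* k ℕ.* y ℕ.+ k ℕ.* k)
        ≡⟨ ℕS.solve 2 (λ y k → y :* y :+ con 2 :* (con 1 :+ y :+ k) :+ (con 1 :+ (con 2 :* k :* y :+ k :* k)) := (con 1 :+ y :+ k) :* (con 1 :+ y :+ k) :+ con 2) refl y k ⟩
      (suc y ℕ.+ k) ℕ.* (suc y ℕ.+ k) ℕ.+ 2     ≡⟨ cong (ℕ._+ 2) e ⟨
      y ℕ.* y ℕ.+ τ ℕ.+ 2                       ≡⟨ ℕP.+-assoc (y ℕ.* y) τ 2 ⟩
      y ℕ.* y ℕ.+ (τ ℕ.+ 2)                     ∎))
    where
    open ℕP.≤-Reasoning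
    open ℕS using (_:+_; _:*_; _:=_; con)

  square-abs : ∀ i → i ℤ.* i ≡ + (ℤ.∣ i ∣ ℕ.* ℤ.∣ i ∣)
  square-abs (+ n)     = sym (ℤP.pos-* n n)
  square-abs -[1+ n ] = refl

-- Consecutive squares around A² are 2|A| ± 1 away.
nonsquare-near-square : ∀ A t Y → t ≢ + 0 → ℤ.∣ t ∣ ℕ.+ 2 ≤ 2 ℕ.* ℤ.∣ A ∣ → Y ℤ.* Y ≢ A ℤ.* A ℤ.+ t
nonsquare-near-square A (+ τ)     Y t≢0 small e = t≢0 (cong +_ (square-above ℤ.∣ A ∣ τ ℤ.∣ Y ∣ (ℤP.+-injective (begin
  + (ℤ.∣ Y ∣ ℕ.* ℤ.∣ Y ∣)              ≡⟨ square-abs Y ⟨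
  Y ℤ.* Y                              ≡⟨ e ⟩
  A ℤ.* A ℤ.+ + τ                      ≡⟨ cong (ℤ._+ + τ) (square-abs A) ⟩
  + (ℤ.∣ A ∣ ℕ.* ℤ.∣ A ∣) ℤ.+ + τ      ≡⟨ ℤP.pos-+ (ℤ.∣ A ∣ ℕ.* ℤ.∣ A ∣) τ ⟨
  + (ℤ.∣ A ∣ ℕ.* ℤ.∣ A ∣ ℕ.+ τ)        ∎)) small))
  where open ≡-Reasoning
nonsquare-near-square A t@(-[1+ τ ]) Y t≢0 small e = ℕP.1+n≢0 (square-below ℤ.∣ A ∣ (suc τ) ℤ.∣ Y ∣ (ℤP.+-injective (begin
  + (ℤ.∣ Y ∣ ℕ.* ℤ.∣ Y ∣ ℕ.+ suc τ)     ≡⟨ ℤP.pos-+ (ℤ.∣ Y ∣ ℕ.* ℤ.∣ Y ∣) (suc τ) ⟩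
  + (ℤ.∣ Y ∣ ℕ.* ℤ.∣ Y ∣) ℤ.+ + suc τ   ≡⟨ cong (ℤ._+ + suc τ) (trans (sym (square-abs Y)) e) ⟩
  A ℤ.* A ℤ.+ t ℤ.+ + suc τ             ≡⟨ ℤP.+-assoc (A ℤ.* A) t (+ suc τ) ⟩
  A ℤ.* A ℤ.+ (t ℤ.+ + suc τ)           ≡⟨ cong (λ x → A ℤ.* A ℤ.+ x) (ℤP.+-inverseˡ (+ suc τ)) ⟩
  A ℤ.* A ℤ.+ + 0                       ≡⟨ ℤP.+-identityʳ (A ℤ.* A) ⟩
  A ℤ.* A                               ≡⟨ square-abs A ⟩
  + (ℤ.∣ A ∣ ℕ.* ℤ.∣ A ∣)               ∎)) small)
  where open ≡-Reasoning

-- With q m = μ and q κ = ν integers, A j and E j clear the denominators of the orbit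
-- a₀ = m² + m, aⱼ₊₁ = aⱼ² + m: for D₀ = q², Dⱼ₊₁ = Dⱼ² one has Dⱼ aⱼ = A j and Dⱼ² = q · E j.
module Orbit (q : ℕ) .{{_ : ℕ.NonZero q}} (μ ν : ℤ) where

  L u : ℕ
  L = q ℕ.* q ℕ.* q
  u = ℤ.∣ μ ∣

  E : ℕ → ℕ
  E zero    = L
  E (suc j) = q ℕ.* (E j ℕ.* E j)

  A : ℕ → ℤ
  A zero    = μ ℤ.* μ ℤ.+ + q ℤ.* μ
  A (suc j) = A j ℤ.* A j ℤ.+ + E j ℤ.* μ

  private
    instance
      L≢0 : ℕ.NonZero L
      L≢0 = ℕP.m*n≢0 (q ℕ.* q) q {{ℕP.m*n≢0 q q}}

    E≢0 : ∀ j → ℕ.NonZero (E j)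
    E≢0 zero    = L≢0
    E≢0 (suc j) = ℕP.m*n≢0 q (E j ℕ.* E j) {{it}} {{ℕP.m*n≢0 (E j) (E j) {{E≢0 j}} {{E≢0 j}}}}
      where it : ℕ.NonZero q
            it = ℕ.≢-nonZero (ℕ.≢-nonZero⁻¹ q)

    E≤E² : ∀ j → E j ≤ E j ℕ.* E j
    E≤E² j = ℕP.m≤m*n (E j) (E j) {{E≢0 j}}

    L≤E : ∀ j → L ≤ E j
    L≤E zero    = ℕP.≤-refl
    L≤E (suc j) = ℕP.≤-trans (L≤E j) (ℕP.≤-trans (E≤E² j) (ℕP.m≤n*m (E j ℕ.* E j) q))

    add-sub : ∀ i j → i ≡ i ℤ.+ j ℤ.- j
    add-sub i j = trans (sym (ℤP.+-identityʳ i)) (trans (cong (λ t → i ℤ.+ t) (sym (ℤP.+-inverseʳ j))) (sym (ℤP.+-assoc i j (ℤ.- j))))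

    -- The triangle inequality, arranged so as to avoid the truncated subtraction of ℕ.
    square≤ : ∀ x y → ℤ.∣ x ∣ ℕ.* ℤ.∣ x ∣ ≤ ℤ.∣ x ℤ.* x ℤ.+ y ∣ ℕ.+ ℤ.∣ y ∣
    square≤ x y = begin
      ℤ.∣ x ∣ ℕ.* ℤ.∣ x ∣                             ≡⟨ ℤP.abs-* x x ⟨
      ℤ.∣ x ℤ.* x ∣                                   ≡⟨ cong ℤ.∣_∣ (add-sub (x ℤ.* x) y) ⟩
      ℤ.∣ x ℤ.* x ℤ.+ y ℤ.- y ∣                       ≤⟨ ℤP.∣i-j∣≤∣i∣+∣j∣ (x ℤ.* x ℤ.+ y) y ⟩
      ℤ.∣ x ℤ.* x ℤ.+ y ∣ ℕ.+ ℤ.∣ y ∣                 ∎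
      where open ℕP.≤-Reasoning

    abs-E* : ∀ n x → ℤ.∣ + n ℤ.* x ∣ ≡ n ℕ.* ℤ.∣ x ∣
    abs-E* n x = ℤP.abs-* (+ n) x

  -- K / L is a lower bound for |A j| / E j: growth makes it propagate and gap makes it suffice.
  module _ (K : ℕ)
    (K≤ : K ℕ.+ q ℕ.* u ≤ u ℕ.* u)
    (growth : L ℕ.* (q ℕ.* K) ℕ.+ L ℕ.* L ℕ.* u ≤ K ℕ.* K)
    (gap : L ℕ.* ℤ.∣ ν ∣ ℕ.+ 2 ≤ 2 ℕ.* K)
    where

    -- Put ρ = |A j| / E j. The recursions for `A` and `E` make the next ratio at least (ρ² - u / E
    -- j) / q, hence at least (ρ² - u) / q because E j ≥ 1. Divided by L², `growth` says that this
    -- is no less than K / L as soon as ρ ≥ K / L. The start is `K≤`, since E 0 = L.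
    A-large : ∀ j → K ℕ.* E j ≤ L ℕ.* ℤ.∣ A j ∣
    A-large zero = ℕP.≤-trans (ℕP.≤-reflexive (ℕP.*-comm K L)) (ℕP.*-monoʳ-≤ L (ℕP.+-cancelʳ-≤ (q ℕ.* u) K ℤ.∣ A 0 ∣
      (ℕP.≤-trans K≤ (ℕP.≤-trans (square≤ μ (+ q ℤ.* μ)) (ℕP.≤-reflexive (cong (ℤ.∣ A 0 ∣ ℕ.+_) (abs-E* q μ)))))))
    A-large (suc j) = ℕP.*-cancelˡ-≤ L (ℕP.+-cancelʳ-≤ (L ℕ.* L ℕ.* u ℕ.* (e ℕ.* e)) _ _ (begin
      L ℕ.* (K ℕ.* (q ℕ.* (e ℕ.* e))) ℕ.+ L ℕ.* L ℕ.* u ℕ.* (e ℕ.* e)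
        ≡⟨ ℕS.solve 5 (λ L K q e u → L :* (K :* (q :* (e :* e))) :+ L :* L :* u :* (e :* e) := (L :* (q :* K) :+ L :* L :* u) :* (e :* e)) refl L K q e u ⟩
      (L ℕ.* (q ℕ.* K) ℕ.+ L ℕ.* L ℕ.* u) ℕ.* (e ℕ.* e)
        ≤⟨ ℕP.*-monoˡ-≤ (e ℕ.* e) growth ⟩
      K ℕ.* K ℕ.* (e ℕ.* e)
        ≡⟨ ℕS.solve 2 (λ K e → K :* K :* (e :* e) := K :* e :* (K :* e)) refl K e ⟩
      K ℕ.* e ℕ.* (K ℕ.* e)
        ≤⟨ ℕP.*-mono-≤ (A-large j) (A-large j) ⟩
      L ℕ.* a ℕ.* (L ℕ.* a)
        ≡⟨ ℕS.solve 2 (λ L a → L :* a :* (L :* a) := L :* L :* (a :* a)) refl L a ⟩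
      L ℕ.* L ℕ.* (a ℕ.* a)
        ≤⟨ ℕP.*-monoʳ-≤ (L ℕ.* L) (square≤ (A j) (+ E j ℤ.* μ)) ⟩
      L ℕ.* L ℕ.* (a′ ℕ.+ ℤ.∣ + E j ℤ.* μ ∣)
        ≡⟨ cong (λ t → L ℕ.* L ℕ.* (a′ ℕ.+ t)) (abs-E* e μ) ⟩
      L ℕ.* L ℕ.* (a′ ℕ.+ e ℕ.* u)
        ≤⟨ ℕP.*-monoʳ-≤ (L ℕ.* L) (ℕP.+-monoʳ-≤ a′ (ℕP.*-monoˡ-≤ u (E≤E² j))) ⟩
      L ℕ.* L ℕ.* (a′ ℕ.+ e ℕ.* e ℕ.* u)
        ≡⟨ ℕS.solve 4 (λ L a e u → L :* L :* (a :+ e :* e :* u) := L :* (L :* a) :+ L :* L :* u :* (e :* e)) refl L a′ e u ⟩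
      L ℕ.* (L ℕ.* a′) ℕ.+ L ℕ.* L ℕ.* u ℕ.* (e ℕ.* e) ∎))
      where
      open ℕP.≤-Reasoning
      open ℕS using (_:+_; _:*_; _:=_)
      e a a′ : ℕ
      e = E j
      a = ℤ.∣ A j ∣
      a′ = ℤ.∣ A (suc j) ∣

    private
      -- Multiplying `gap` by E j turns its 2 into 2 E j ≥ 2 L, which pays for the 2 that must
      -- remain after division by L.
      Eν-small : ∀ j → ℤ.∣ + E j ℤ.* ν ∣ ℕ.+ 2 ≤ 2 ℕ.* ℤ.∣ A j ∣
      Eν-small j = ℕP.*-cancelˡ-≤ L (begin
        L ℕ.* (ℤ.∣ + E j ℤ.* ν ∣ ℕ.+ 2)          ≡⟨ cong (λ t → L ℕ.* (t ℕ.+ 2)) (abs-E* (E j) ν) ⟩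
        L ℕ.* (E j ℕ.* n ℕ.+ 2)                  ≡⟨ ℕS.solve 3 (λ L e n → L :* (e :* n :+ con 2) := e :* (L :* n) :+ L :* con 2) refl L (E j) n ⟩
        E j ℕ.* (L ℕ.* n) ℕ.+ L ℕ.* 2            ≤⟨ ℕP.+-monoʳ-≤ (E j ℕ.* (L ℕ.* n)) (ℕP.*-monoˡ-≤ 2 (L≤E j)) ⟩
        E j ℕ.* (L ℕ.* n) ℕ.+ E j ℕ.* 2          ≡⟨ ℕP.*-distribˡ-+ (E j) (L ℕ.* n) 2 ⟨
        E j ℕ.* (L ℕ.* n ℕ.+ 2)                  ≤⟨ ℕP.*-monoʳ-≤ (E j) gap ⟩
        E j ℕ.* (2 ℕ.* K)                        ≡⟨ ℕS.solve 2 (λ e K → e :* (con 2 :* K) := con 2 :* (K :* e)) refl (E j) K ⟩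
        2 ℕ.* (K ℕ.* E j)                        ≤⟨ ℕP.*-monoʳ-≤ 2 (A-large j) ⟩
        2 ℕ.* (L ℕ.* ℤ.∣ A j ∣)                  ≡⟨ ℕS.solve 2 (λ L a → con 2 :* (L :* a) := L :* (con 2 :* a)) refl L ℤ.∣ A j ∣ ⟩
        L ℕ.* (2 ℕ.* ℤ.∣ A j ∣)                  ∎)
        where
        open ℕP.≤-Reasoning
        open ℕS using (_:+_; _:*_; _:=_; con)
        n = ℤ.∣ ν ∣

    A²+Eν-nonsquare : ν ≢ + 0 → ∀ j Y → Y ℤ.* Y ≢ A j ℤ.* A j ℤ.+ + E j ℤ.* ν
    A²+Eν-nonsquare ν≢0 j Y = nonsquare-near-square (A j) (+ E j ℤ.* ν) Y Eν≢0 (Eν-small j)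
      where
      Eν≢0 : + E j ℤ.* ν ≢ + 0
      Eν≢0 e = [ (λ E≡0 → ℕ.≢-nonZero⁻¹ (E j) {{E≢0 j}} (ℤP.+-injective E≡0)) , ν≢0 ]′ (ℤP.i*j≡0⇒i≡0∨j≡0 (+ E j) e)

    module _ (m κ : ℚ) (qm≡μ : ℕtoℚ q * m ≡ ℤtoℚ μ) (qκ≡ν : ℕtoℚ q * κ ≡ ℤtoℚ ν) (κ≢0 : κ ≢ 0ℚ)
      (a : ℕ → ℚ) (a-zero : a 0 ≡ m * m + m) (a-suc : ∀ j → a (suc j) ≡ a j * a j + m) where

      private
        Q : ℚ
        Q = ℕtoℚ q

        D : ℕ → ℚ
        D zero    = Q * Q
        D (suc j) = D j * D j

        ℕtoℚ-E-zero : ℕtoℚ (E 0) ≡ Q * Q * Q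
        ℕtoℚ-E-zero = trans (ℕtoℚ-* (q ℕ.* q) q) (cong (_* Q) (ℕtoℚ-* q q))

        ℕtoℚ-E-suc : ∀ j → ℕtoℚ (E (suc j)) ≡ Q * (ℕtoℚ (E j) * ℕtoℚ (E j))
        ℕtoℚ-E-suc j = trans (ℕtoℚ-* q (E j ℕ.* E j)) (cong (Q *_) (ℕtoℚ-* (E j) (E j)))

        ℤtoℚ-sq+ : ∀ x n y → ℤtoℚ (x ℤ.* x ℤ.+ + n ℤ.* y) ≡ ℤtoℚ x * ℤtoℚ x + ℕtoℚ n * ℤtoℚ y
        ℤtoℚ-sq+ x n y = trans (ℤtoℚ-+ (x ℤ.* x) (+ n ℤ.* y)) (cong₂ _+_ (ℤtoℚ-* x x) (ℤtoℚ-* (+ n) y))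

        open ℚS using (solve; _:+_; _:*_; _:=_)

        D² : ∀ j → D j * D j ≡ Q * ℕtoℚ (E j)
        D² zero    = trans (solve 1 (λ Q → Q :* Q :* (Q :* Q) := Q :* (Q :* Q :* Q)) refl Q) (cong (Q *_) (sym ℕtoℚ-E-zero))
        D² (suc j) = begin
          D j * D j * (D j * D j)                            ≡⟨ cong₂ _*_ (D² j) (D² j) ⟩
          Q * ℕtoℚ (E j) * (Q * ℕtoℚ (E j))                  ≡⟨ solve 2 (λ Q e → Q :* e :* (Q :* e) := Q :* (Q :* (e :* e))) refl Q (ℕtoℚ (E j)) ⟩
          Q * (Q * (ℕtoℚ (E j) * ℕtoℚ (E j)))                ≡⟨ cong (Q *_) (ℕtoℚ-E-suc j) ⟨
          Q * ℕtoℚ (E (suc j))                               ∎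
          where open ≡-Reasoning

        -- With r = m this advances the orbit; with r = κ it clears the denominators of the
        -- candidate square.
        clear : ∀ x j r ρ → D j * x ≡ ℤtoℚ (A j) → Q * r ≡ ℤtoℚ ρ →
                D j * D j * (x * x + r) ≡ ℤtoℚ (A j ℤ.* A j ℤ.+ + E j ℤ.* ρ)
        clear x j r ρ Dx≡A Qr≡ρ = begin
          D j * D j * (x * x + r)                              ≡⟨ solve 3 (λ D x r → D :* D :* (x :* x :+ r) := D :* x :* (D :* x) :+ D :* D :* r) refl (D j) x r ⟩
          D j * x * (D j * x) + D j * D j * r                  ≡⟨ cong₂ _+_ (cong₂ _*_ Dx≡A Dx≡A) (cong (_* r) (D² j)) ⟩
          ℤtoℚ (A j) * ℤtoℚ (A j) + Q * ℕtoℚ (E j) * r         ≡⟨ cong (λ t → ℤtoℚ (A j) * ℤtoℚ (A j) + t) (solve 3 (λ Q e r → Q :* e :* r := e :* (Q :* r)) refl Q (ℕtoℚ (E j)) r) ⟩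
          ℤtoℚ (A j) * ℤtoℚ (A j) + ℕtoℚ (E j) * (Q * r)       ≡⟨ cong (λ t → ℤtoℚ (A j) * ℤtoℚ (A j) + ℕtoℚ (E j) * t) Qr≡ρ ⟩
          ℤtoℚ (A j) * ℤtoℚ (A j) + ℕtoℚ (E j) * ℤtoℚ ρ        ≡⟨ ℤtoℚ-sq+ (A j) (E j) ρ ⟨
          ℤtoℚ (A j ℤ.* A j ℤ.+ + E j ℤ.* ρ)                   ∎
          where open ≡-Reasoning

        D*a : ∀ j → D j * a j ≡ ℤtoℚ (A j)
        D*a zero    = begin
          Q * Q * a 0                      ≡⟨ cong (Q * Q *_) a-zero ⟩
          Q * Q * (m * m + m)              ≡⟨ solve 2 (λ Q m → Q :* Q :* (m :* m :+ m) := Q :* m :* (Q :* m) :+ Q :* (Q :* m)) refl Q m ⟩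
          Q * m * (Q * m) + Q * (Q * m)    ≡⟨ cong (λ t → t * t + Q * t) qm≡μ ⟩
          ℤtoℚ μ * ℤtoℚ μ + Q * ℤtoℚ μ     ≡⟨ ℤtoℚ-sq+ μ q μ ⟨
          ℤtoℚ (A 0)                       ∎
          where open ≡-Reasoning
        D*a (suc j) = trans (cong (D j * D j *_) (a-suc j)) (clear (a j) j m μ (D*a j) qm≡μ)

        ν≢0 : ν ≢ + 0
        ν≢0 ν≡0 = κ≢0 (ℚ-integral Q κ (trans qκ≡ν (cong ℤtoℚ ν≡0)) λ Q≡0 → ℕ.≢-nonZero⁻¹ q (ℤP.+-injective (ℤtoℚ-injective (+ q) (+ 0) Q≡0)))

      orbit-nonsquare : ∀ j s → s * s ≢ a j * a j + κ
      orbit-nonsquare j s e = A²+Eν-nonsquare ν≢0 j (proj₁ Y) (proj₂ Y)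
        where
        Y : ∃ λ Y → Y ℤ.* Y ≡ A j ℤ.* A j ℤ.+ + E j ℤ.* ν
        -- The rational `D j * s` has an integral square, hence is itself integral.
        Y = ℚ-square-integral (D j * s) _ (trans (solve 2 (λ D s → D :* s :* (D :* s) := D :* D :* (s :* s)) refl (D j) s)
              (trans (cong (D j * D j *_) e) (clear (a j) j κ ν (D*a j) qκ≡ν)))

-- Iterates of a quadratic polynomial

monic-+small : ∀ p r n → Monic p n → DegLt r n → Monic (p +ₚ r) n
monic-+small p r n (d , l) dr = degLt-+ p r (suc n) d (degLt-mono r (ℕP.n≤1+n n) dr) ,
  trans (coeff-+ p r n) (trans (cong₂ _+_ l (dr n ℕP.≤-refl)) refl)

const-degLt : ∀ a n → 1 ≤ n → DegLt (constₚ a) n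
const-degLt a (suc n) _ (suc i) _ = refl

-- This is 2^n, by doubling, so that the degree of every iterate after the zeroth has by definition
-- the shape e + e that the norm lemmas expect.
iterDeg : ℕ → ℕ
iterDeg zero    = 1
iterDeg (suc n) = iterDeg n ℕ.+ iterDeg n

1≤iterDeg : ∀ n → 1 ≤ iterDeg n
1≤iterDeg zero    = ℕP.≤-refl
1≤iterDeg (suc n) = ℕP.≤-trans (1≤iterDeg n) (ℕP.m≤m+n (iterDeg n) (iterDeg n))

module StableQuadratic (γ m : ℚ) (f z w : Poly) (z-shape : z ≋ - γ ∷ 1ℚ ∷ []) (w-shape : w ≋ - (γ + m) ∷ 1ℚ ∷ [])
  (f-shape : f ≋ (z *ₚ z) +ₚ constₚ (γ + m)) where

  private κ = γ + m
  open ℚS using (solve; con; _:+_; _:*_; _:-_; :-_; _:=_)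
  open Quadratic γ κ f z w z-shape w-shape

  z-∘ : ∀ p → z ∘ₚ p ≋ p +ₚ constₚ (- γ)
  z-∘ p = ≋-trans (Comp.∘-congʳ p z (- γ ∷ 1ℚ ∷ []) z-shape) (linear-∘ (- γ) p)

  f-∘ : ∀ p → f ∘ₚ p ≋ ((p +ₚ constₚ (- γ)) *ₚ (p +ₚ constₚ (- γ))) +ₚ constₚ κ
  f-∘ p = begin
    f ∘ₚ p                                     ≈⟨ Comp.∘-congʳ p f ((z *ₚ z) +ₚ constₚ κ) f-shape ⟩
    ((z *ₚ z) +ₚ constₚ κ) ∘ₚ p                ≈⟨ Comp.∘-+ p (z *ₚ z) (constₚ κ) ⟩
    ((z *ₚ z) ∘ₚ p) +ₚ (constₚ κ ∘ₚ p)         ≈⟨ +ₚ-cong (≋-trans (Comp.∘-* p z z) (*ₚ-cong (z-∘ p) (z-∘ p))) (const-∘ κ p) ⟩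
    ((p +ₚ constₚ (- γ)) *ₚ (p +ₚ constₚ (- γ))) +ₚ constₚ κ ∎
    where open ≋-Reasoning

  iter-monic : ∀ n → Monic (iterₚ f n) (iterDeg n)
  iter-monic zero    = (λ { (suc (suc i)) _ → refl ; (suc zero) (s≤s ()) }) , refl
  iter-monic (suc n) = monic-cong (iterDeg (suc n)) (≋-sym (f-∘ p))
    (monic-*+small (p +ₚ constₚ (- γ)) (p +ₚ constₚ (- γ)) (iterDeg n) (iterDeg n) (constₚ κ) shifted shifted
      (const-degLt κ (iterDeg (suc n)) (1≤iterDeg (suc n))))
    where
    p = iterₚ f n
    shifted : Monic (p +ₚ constₚ (- γ)) (iterDeg n)
    shifted = monic-+small p (constₚ (- γ)) (iterDeg n) (iter-monic n) (const-degLt (- γ) (iterDeg n) (1≤iterDeg n))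

  iter-nonconst : ∀ n → ¬ IsConst (iterₚ f n)
  iter-nonconst n c = proj₂ (monic⇒hasDeg (iterₚ f n) (iterDeg n) (iter-monic n)) (c (iterDeg n) (1≤iterDeg n))

  eval-linear : ∀ p a x → p ≋ a ∷ 1ℚ ∷ [] → eval p x ≡ x + a
  eval-linear p a x e = trans (Eval.eval-cong x p (a ∷ 1ℚ ∷ []) e)
    (solve 2 (λ a x → a :+ x :* (con 1ℚ :+ x :* con 0ℚ) := x :+ a) refl a x)

  eval-f : ∀ x → eval f x ≡ (x - γ) * (x - γ) + κ
  eval-f x = begin
    eval f x                               ≡⟨ Eval.eval-cong x f ((z *ₚ z) +ₚ constₚ κ) f-shape ⟩
    eval ((z *ₚ z) +ₚ constₚ κ) x          ≡⟨ Eval.eval-+ x (z *ₚ z) (constₚ κ) ⟩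
    eval (z *ₚ z) x + eval (constₚ κ) x    ≡⟨ cong₂ _+_ (trans (Eval.eval-* x z z) (cong (λ t → t * t) (eval-linear z (- γ) x z-shape))) (eval-const κ x) ⟩
    (x - γ) * (x - γ) + κ                  ∎
    where open ≡-Reasoning

  eval-f-γ : eval f γ ≡ κ
  eval-f-γ = trans (eval-f γ) (solve 2 (λ g k → (g :- g) :* (g :- g) :+ k := k) refl γ κ)

  eval-f-κ : eval f κ ≡ m * m + κ
  eval-f-κ = trans (eval-f κ) (solve 2 (λ g m → (g :+ m :- g) :* (g :+ m :- g) :+ (g :+ m) := m :* m :+ (g :+ m)) refl γ m)

  eval-iter : ∀ n x → eval (iterₚ f (suc n)) x ≡ eval f (eval (iterₚ f n) x)
  eval-iter n x = eval-∘ f (iterₚ f n) x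

  -- Since κ = f(γ), this is f^(j+2)(γ) - γ. The earlier difference f(γ) - γ = m belongs to the case
  -- n = 1.
  orbit : ℕ → ℚ
  orbit j = eval (iterₚ f (suc j)) κ - γ

  eval-iter-orbit : ∀ j → eval (iterₚ f (suc (suc j))) κ ≡ orbit j * orbit j + κ
  eval-iter-orbit j = trans (eval-iter (suc j) κ) (eval-f (eval (iterₚ f (suc j)) κ))

  eval-iter-1 : ∀ x → eval (iterₚ f 1) x ≡ eval f x
  eval-iter-1 x = Eval.eval-cong x (iterₚ f 1) f (∘-X f)

  private
    sub-γ : ∀ t → t + κ - γ ≡ t + m
    sub-γ t = solve 3 (λ t g m → t :+ (g :+ m) :- g := t :+ m) refl t γ m

  orbit-zero : orbit 0 ≡ m * m + m
  orbit-zero = trans (cong (_- γ) (trans (eval-iter-1 κ) eval-f-κ)) (sub-γ (m * m))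

  orbit-suc : ∀ j → orbit (suc j) ≡ orbit j * orbit j + m
  orbit-suc j = trans (cong (_- γ) (eval-iter-orbit j)) (sub-γ (orbit j * orbit j))

  private
    -- As u is the square of the leading coefficient of A, u ≠ 0 permits division by that
    -- coefficient.
    norm-inverse : ∀ P e → Monic P (e ℕ.+ e) → ∀ A B u → u ≢ 0ℚ → norm A B ≋ constₚ u *ₚ P → ∃ λ y → y * coeff A e ≡ 1ℚ
    norm-inverse P e mP A B u u≢0 N≋uP = ℚ-inverse λ α≡0 → u≢0
      (trans (proj₂ (proj₂ (norm-associate P e mP A B u N≋uP))) (trans (cong (_* coeff A e) α≡0) (ℚP.*-zeroˡ (coeff A e))))

    eval-associate : ∀ P e → Monic P (e ℕ.+ e) → ∀ A B u → norm A B ≋ constₚ u *ₚ P →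
      ∀ x → eval (norm A B) x ≡ coeff A e * coeff A e * eval P x
    eval-associate P e mP A B u N≋uP x = begin
      eval (norm A B) x                     ≡⟨ Eval.eval-cong x (norm A B) (constₚ u *ₚ P) N≋uP ⟩
      eval (constₚ u *ₚ P) x                ≡⟨ Eval.eval-* x (constₚ u) P ⟩
      eval (constₚ u) x * eval P x          ≡⟨ cong (_* eval P x) (eval-const u x) ⟩
      u * eval P x                          ≡⟨ cong (_* eval P x) (proj₂ (proj₂ (norm-associate P e mP A B u N≋uP))) ⟩
      coeff A e * coeff A e * eval P x      ∎
      where open ≡-Reasoning

    square-quotient : ∀ S α y v → y * α ≡ 1ℚ → S * S ≡ α * α * v → S * y * (S * y) ≡ v
    square-quotient S α y v yα≡1 S²≡α²v = begin
      S * y * (S * y)          ≡⟨ solve 2 (λ S y → S :* y :* (S :* y) := y :* y :* (S :* S)) refl S y ⟩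
      y * y * (S * S)          ≡⟨ cong (y * y *_) S²≡α²v ⟩
      y * y * (α * α * v)      ≡⟨ solve 3 (λ y α v → y :* y :* (α :* α :* v) := y :* α :* (y :* α) :* v) refl y α v ⟩
      y * α * (y * α) * v      ≡⟨ cong (λ t → t * t * v) yα≡1 ⟩
      1ℚ * 1ℚ * v              ≡⟨ ℚP.*-identityˡ v ⟩
      v                        ∎
      where open ≡-Reasoning

  norm⇒square : ∀ P e → Monic P (e ℕ.+ e) → ∀ A B u → u ≢ 0ℚ → norm A B ≋ constₚ u *ₚ P → ∃ λ s → s * s ≡ eval P κ
  norm⇒square P e mP A B u u≢0 N≋uP = eval A κ * y , square-quotient (eval A κ) (coeff A e) y (eval P κ) yα≡1
      (trans (sym (eval-norm-κ A B)) (eval-associate P e mP A B u N≋uP κ))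
    where
    y = proj₁ (norm-inverse P e mP A B u u≢0 N≋uP)
    yα≡1 = proj₂ (norm-inverse P e mP A B u u≢0 N≋uP)

  -- The norm of A + B√w with A = a₀ + α t, B = b is α² f, and comparing values at κ and κ + 1
  -- gives (A(κ)/α)² = f²(γ) and (b/2α)² = (−m + A(κ)/α)/2.
  norm≉f : κ ≢ 0ℚ →
    (∀ s → s * s ≡ eval f (eval f γ) → ¬ IsNonzeroRatSquare ((- m + s) * ½)) →
    ∀ A B u → u ≢ 0ℚ → ¬ norm A B ≋ constₚ u *ₚ iterₚ f 1
  norm≉f κ≢0 not-square A B u u≢0 N≋uf = not-square s s²≡ff (t , t≢0 , t²≡)
    where
    open ≡-Reasoning
    P = iterₚ f 1
    mP : Monic P (1 ℕ.+ 1)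
    mP = iter-monic 1
    dA : DegLt A 2
    dA = proj₁ (norm-associate P 1 mP A B u N≋uf)
    dB : DegLt B 1
    dB = proj₁ (proj₂ (norm-associate P 1 mP A B u N≋uf))
    S α b y s t : ℚ
    S = eval A κ
    α = coeff A 1
    b = coeff B 0
    y = proj₁ (norm-inverse P 1 mP A B u u≢0 N≋uf)
    s = S * y
    t = b * y * ½
    yα≡1 : y * α ≡ 1ℚ
    yα≡1 = proj₂ (norm-inverse P 1 mP A B u u≢0 N≋uf)
    A-linear : A ≋ coeff A 0 ∷ α ∷ []
    A-linear = coeffwise λ { zero → refl ; (suc zero) → refl ; (suc (suc i)) → dA (suc (suc i)) (s≤s (s≤s z≤n)) }
    -- At κ + 1 the polynomial w takes the value 1 and B its constant b, so this second value
    -- isolates b².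
    eval-A : eval A (κ + 1ℚ) ≡ S + α
    eval-A = begin
      eval A (κ + 1ℚ)                                  ≡⟨ Eval.eval-cong (κ + 1ℚ) A _ A-linear ⟩
      eval (coeff A 0 ∷ α ∷ []) (κ + 1ℚ)               ≡⟨ solve 3 (λ a α k → a :+ (k :+ con 1ℚ) :* (α :+ (k :+ con 1ℚ) :* con 0ℚ) := a :+ k :* (α :+ k :* con 0ℚ) :+ α) refl (coeff A 0) α κ ⟩
      eval (coeff A 0 ∷ α ∷ []) κ + α                  ≡⟨ cong (_+ α) (Eval.eval-cong κ A _ A-linear) ⟨
      S + α                                            ∎
    eval-w+1 : eval w (κ + 1ℚ) ≡ 1ℚ
    eval-w+1 = trans (eval-linear w (- κ) (κ + 1ℚ) w-shape) (solve 1 (λ k → k :+ con 1ℚ :+ (:- k) := con 1ℚ) refl κ)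
    eval-B : eval B (κ + 1ℚ) ≡ b
    eval-B = trans (Eval.eval-cong (κ + 1ℚ) B (constₚ b) (const-≋ B dB)) (eval-const b (κ + 1ℚ))
    at-κ : S * S ≡ α * α * (m * m + κ)
    at-κ = trans (sym (eval-norm-κ A B)) (trans (eval-associate P 1 mP A B u N≋uf κ)
      (cong (α * α *_) (trans (eval-iter-1 κ) eval-f-κ)))
    at-κ+1 : (S + α) * (S + α) - b * b ≡ α * α * ((m + 1ℚ) * (m + 1ℚ) + κ)
    at-κ+1 = begin
      (S + α) * (S + α) - b * b              ≡⟨ cong (λ t → (S + α) * (S + α) - t) (ℚP.*-identityˡ (b * b)) ⟨
      (S + α) * (S + α) - 1ℚ * (b * b)       ≡⟨ cong₂ _-_ (cong (λ t → t * t) eval-A) (cong₂ _*_ eval-w+1 (cong (λ t → t * t) eval-B)) ⟨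
      eval A (κ + 1ℚ) * eval A (κ + 1ℚ) - eval w (κ + 1ℚ) * (eval B (κ + 1ℚ) * eval B (κ + 1ℚ)) ≡⟨ eval-norm A B (κ + 1ℚ) ⟨
      eval (norm A B) (κ + 1ℚ)               ≡⟨ eval-associate P 1 mP A B u N≋uf (κ + 1ℚ) ⟩
      α * α * eval P (κ + 1ℚ)                ≡⟨ cong (α * α *_) (trans (eval-iter-1 (κ + 1ℚ)) (eval-f (κ + 1ℚ))) ⟩
      α * α * ((κ + 1ℚ - γ) * (κ + 1ℚ - γ) + κ) ≡⟨ cong (λ t → α * α * (t * t + κ)) (solve 2 (λ g m → g :+ m :+ con 1ℚ :- g := m :+ con 1ℚ) refl γ m) ⟩
      α * α * ((m + 1ℚ) * (m + 1ℚ) + κ)      ∎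
    s² : s * s ≡ m * m + κ
    s² = square-quotient S α y (m * m + κ) yα≡1 at-κ
    -- The sign of s = A(κ) / α is whatever A gives; the hypothesis covers both square roots.
    s²≡ff : s * s ≡ eval f (eval f γ)
    s²≡ff = trans s² (sym (trans (cong (eval f) eval-f-γ) eval-f-κ))
    -- Subtracting the two values of the norm removes S² and κ together.
    b² : b * b ≡ (S * α - m * (α * α)) + (S * α - m * (α * α))
    b² = begin
      b * b
        ≡⟨ solve 3 (λ S α b → b :* b := (S :* S :+ (S :* α :+ S :* α) :+ α :* α) :- ((S :+ α) :* (S :+ α) :- b :* b)) refl S α b ⟩
      (S * S + (S * α + S * α) + α * α) - ((S + α) * (S + α) - b * b)
        ≡⟨ cong₂ (λ v v′ → (v + (S * α + S * α) + α * α) - v′) at-κ at-κ+1 ⟩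
      (α * α * (m * m + κ) + (S * α + S * α) + α * α) - α * α * ((m + 1ℚ) * (m + 1ℚ) + κ)
        ≡⟨ solve 4 (λ S α m k → (α :* α :* (m :* m :+ k) :+ (S :* α :+ S :* α) :+ α :* α) :- α :* α :* ((m :+ con 1ℚ) :* (m :+ con 1ℚ) :+ k)
             := (S :* α :- m :* (α :* α)) :+ (S :* α :- m :* (α :* α))) refl S α m κ ⟩
      (S * α - m * (α * α)) + (S * α - m * (α * α)) ∎
    t²≡ : t * t ≡ (- m + s) * ½
    t²≡ = begin
      b * y * ½ * (b * y * ½)
        ≡⟨ solve 2 (λ b y → b :* y :* con ½ :* (b :* y :* con ½) := b :* b :* (y :* y :* (con ½ :* con ½))) refl b y ⟩
      b * b * (y * y * (½ * ½))
        ≡⟨ cong (_* (y * y * (½ * ½))) b² ⟩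
      ((S * α - m * (α * α)) + (S * α - m * (α * α))) * (y * y * (½ * ½))
        ≡⟨ solve 4 (λ S α m y → ((S :* α :- m :* (α :* α)) :+ (S :* α :- m :* (α :* α))) :* (y :* y :* (con ½ :* con ½))
             := ((:- m) :* (y :* α) :+ S :* y) :* (y :* α) :* con ½) refl S α m y ⟩
      (- m * (y * α) + S * y) * (y * α) * ½
        ≡⟨ cong (λ v → (- m * v + S * y) * v * ½) yα≡1 ⟩
      (- m * 1ℚ + S * y) * 1ℚ * ½
        ≡⟨ solve 2 (λ m s → ((:- m) :* con 1ℚ :+ s) :* con 1ℚ :* con ½ := ((:- m) :+ s) :* con ½) refl m s ⟩
      (- m + s) * ½ ∎
    -- For t = 0 one has s = m, and then κ = s² - m² = 0.
    t≢0 : t ≢ 0ℚ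
    t≢0 t≡0 = κ≢0 (begin
      κ                                       ≡⟨ solve 2 (λ m k → k := m :* m :+ k :- m :* m) refl m κ ⟩
      m * m + κ - m * m                       ≡⟨ cong (_- m * m) s² ⟨
      s * s - m * m                           ≡⟨ solve 2 (λ m s → s :* s :- m :* m := (((:- m) :+ s) :* con ½) :* (m :+ s) :* (con 1ℚ :+ con 1ℚ)) refl m s ⟩
      (- m + s) * ½ * (m + s) * (1ℚ + 1ℚ)     ≡⟨ cong (λ v → v * (m + s) * (1ℚ + 1ℚ)) (trans (sym t²≡) (cong (λ v → v * v) t≡0)) ⟩
      0ℚ * 0ℚ * (m + s) * (1ℚ + 1ℚ)           ≡⟨ solve 1 (λ v → con 0ℚ :* con 0ℚ :* v :* (con 1ℚ :+ con 1ℚ) := con 0ℚ) refl (m + s) ⟩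
      0ℚ                                      ∎)

  irreducible⇒κ≢0 : Irreducible f → κ ≢ 0ℚ
  irreducible⇒κ≢0 irr κ≡0 = [ nonconst , nonconst ]′ (proj₂ irr z z (at f≋zz))
    where
    f≋zz : f ≋ z *ₚ z
    f≋zz = ≋-trans f-shape (≋-trans (+ₚ-cong (≋-refl {z *ₚ z}) (≋-trans (∷-cong κ≡0 ≋-refl) 0∷[])) (+ₚ-identityʳ (z *ₚ z)))
    nonconst : ¬ IsConst z
    nonconst c = 1≢0 (trans (sym (at z-shape 1)) (c 1 ℕP.≤-refl))

  stable : Irreducible f →
    (∀ s → s * s ≡ eval f (eval f γ) → ¬ IsNonzeroRatSquare ((- m + s) * ½)) →
    (∀ j s → s * s ≢ orbit j * orbit j + κ) → Stable f
  stable irr not-square orbit-nonsquare (suc n) _ = go n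
    where
    noNorm : ∀ n A B u → u ≢ 0ℚ → ¬ norm A B ≋ constₚ u *ₚ iterₚ f (suc n)
    noNorm zero    A B u u≢0 N≋uP = norm≉f (irreducible⇒κ≢0 irr) not-square A B u u≢0 N≋uP
    noNorm (suc j) A B u u≢0 N≋uP = orbit-nonsquare j (proj₁ square) (trans (proj₂ square) (eval-iter-orbit j))
      where
      square : ∃ λ s → s * s ≡ eval (iterₚ f (suc (suc j))) κ
      square = norm⇒square (iterₚ f (suc (suc j))) (iterDeg (suc j)) (iter-monic (suc (suc j))) A B u u≢0 N≋uP
    go : ∀ n → Irreducible (iterₚ f (suc n))
    go zero    = irreducible-cong (≋-sym (∘-X f)) irr
    go (suc n) = irreducible-cong (≋-sym (iter-suc f (suc n)))
      (∘-irreducible f-shape (iterₚ f (suc n)) (go n)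
        (λ c → iter-nonconst (suc (suc n)) (degLt-cong 1 (≋-sym (iter-suc f (suc n))) c)) (noNorm n))

-- The size condition

private
  <-square⇒< : ∀ m n → m ℕ.* m ℕ.< n ℕ.* n → m ℕ.< n
  <-square⇒< m n m²<n² with ℕP.≤-<-connex n m
  ... | inj₁ n≤m = ⊥-elim (ℕP.<⇒≱ m²<n² (ℕP.*-mono-≤ n≤m n≤m))
  ... | inj₂ m<n = m<n

  -- Here q = 4, L = 64, u = 4 |m|, and K = u (u - 4) is the largest value that `K≤` permits. With
  -- 33 + t for u - 4, the estimates 4096 ≤ 125 · 33 and 256 + 125 = 381 ≤ 37 · 33 suffice.
  growth₄ : ∀ t → let u = 37 ℕ.+ t ; K = u ℕ.* (33 ℕ.+ t) in
            64 ℕ.* (4 ℕ.* K) ℕ.+ 64 ℕ.* 64 ℕ.* u ≤ K ℕ.* K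
  growth₄ t = begin
    64 ℕ.* (4 ℕ.* K) ℕ.+ 64 ℕ.* 64 ℕ.* u      ≡⟨ ℕS.solve 2 (λ u v → con 64 :* (con 4 :* (u :* v)) :+ con 4096 :* u := u :* (con 256 :* v :+ con 4096)) refl u v ⟩
    u ℕ.* (256 ℕ.* v ℕ.+ 4096)                ≤⟨ ℕP.*-monoʳ-≤ u (ℕP.+-monoʳ-≤ (256 ℕ.* v) 4096≤125v) ⟩
    u ℕ.* (256 ℕ.* v ℕ.+ 125 ℕ.* v)           ≡⟨ ℕS.solve 2 (λ u v → u :* (con 256 :* v :+ con 125 :* v) := u :* v :* con 381) refl u v ⟩
    u ℕ.* v ℕ.* 381                           ≤⟨ ℕP.*-monoʳ-≤ (u ℕ.* v) (ℕP.≤-trans (ℕP.m≤m+n 381 840) (ℕP.*-mono-≤ (ℕP.m≤m+n 37 t) (ℕP.m≤m+n 33 t))) ⟩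
    K ℕ.* K                                   ∎
    where
    open ℕP.≤-Reasoning
    open ℕS using (_:+_; _:*_; _:=_; con)
    u v K : ℕ
    u = 37 ℕ.+ t
    v = 33 ℕ.+ t
    K = u ℕ.* v
    4096≤125v : 4096 ≤ 125 ℕ.* v
    4096≤125v = ℕP.≤-trans (ℕP.m≤m+n 4096 29) (ℕP.*-monoʳ-≤ 125 (ℕP.m≤m+n 33 t))

  -- Here v = u - 24. The factor 9 fits the hypothesis to the goal, as 9 · 64 = 16 · 36, and 2320 =
  -- 16 · 145 collects the constants. The main terms are then 16 v² against 18 u²: this is what the
  -- factor 3 before the square root buys.
  gap₄ : ∀ t g n → let u = 37 ℕ.+ t ; v = 13 ℕ.+ t ; K = u ℕ.* (33 ℕ.+ t) in
         36 ℕ.* g ℕ.+ 144 ℕ.< v ℕ.* v → n ≤ u ℕ.+ g → 64 ℕ.* n ℕ.+ 2 ≤ 2 ℕ.* K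
  gap₄ t g n 36g+144<v² n≤u+g = ℕP.*-cancelˡ-≤ 9 (ℕP.+-cancelʳ-≤ 2320 (9 ℕ.* (64 ℕ.* n ℕ.+ 2)) (9 ℕ.* (2 ℕ.* K)) (begin
    9 ℕ.* (64 ℕ.* n ℕ.+ 2) ℕ.+ 2320
      ≤⟨ ℕP.+-monoˡ-≤ 2320 (ℕP.*-monoʳ-≤ 9 (ℕP.+-monoˡ-≤ 2 (ℕP.*-monoʳ-≤ 64 n≤u+g))) ⟩
    9 ℕ.* (64 ℕ.* (u ℕ.+ g) ℕ.+ 2) ℕ.+ 2320
      ≡⟨ ℕS.solve 2 (λ u g → con 9 :* (con 64 :* (u :+ g) :+ con 2) :+ con 2320 := con 576 :* u :+ con 18 :+ con 16 :* (con 1 :+ (con 36 :* g :+ con 144))) refl u g ⟩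
    576 ℕ.* u ℕ.+ 18 ℕ.+ 16 ℕ.* suc (36 ℕ.* g ℕ.+ 144)
      ≤⟨ ℕP.+-monoʳ-≤ (576 ℕ.* u ℕ.+ 18) (ℕP.*-monoʳ-≤ 16 36g+144<v²) ⟩
    576 ℕ.* u ℕ.+ 18 ℕ.+ 16 ℕ.* (v ℕ.* v)
      ≤⟨ ℕP.m≤m+n _ (264 ℕ.+ 268 ℕ.* t ℕ.+ 2 ℕ.* t ℕ.* t) ⟩
    576 ℕ.* u ℕ.+ 18 ℕ.+ 16 ℕ.* (v ℕ.* v) ℕ.+ (264 ℕ.+ 268 ℕ.* t ℕ.+ 2 ℕ.* t ℕ.* t)
      ≡⟨ ℕS.solve 1 (λ t → con 576 :* (con 37 :+ t) :+ con 18 :+ con 16 :* ((con 13 :+ t) :* (con 13 :+ t)) :+ (con 264 :+ con 268 :* t :+ con 2 :* t :* t)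
           := con 9 :* (con 2 :* ((con 37 :+ t) :* (con 33 :+ t))) :+ con 2320) refl t ⟩
    9 ℕ.* (2 ℕ.* K) ℕ.+ 2320 ∎))
    where
    open ℕP.≤-Reasoning
    open ℕS using (_:+_; _:*_; _:=_; con)
    u v K : ℕ
    u = 37 ℕ.+ t
    v = 13 ℕ.+ t
    K = u ℕ.* (33 ℕ.+ t)

  -- The integral case: q = L = 1, u = |m| and K = u (u - 1).
  growth₁ : ∀ t → let u = 3 ℕ.+ t ; K = u ℕ.* (2 ℕ.+ t) in 1 ℕ.* (1 ℕ.* K) ℕ.+ 1 ℕ.* 1 ℕ.* u ≤ K ℕ.* K
  growth₁ t = begin
    1 ℕ.* (1 ℕ.* K) ℕ.+ 1 ℕ.* 1 ℕ.* u   ≡⟨ ℕS.solve 2 (λ K u → con 1 :* (con 1 :* K) :+ con 1 :* u := K :+ u :* con 1) refl K u ⟩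
    K ℕ.+ u ℕ.* 1                       ≤⟨ ℕP.+-monoʳ-≤ K (ℕP.*-monoʳ-≤ u {1} {2 ℕ.+ t} (s≤s z≤n)) ⟩
    K ℕ.+ K                             ≡⟨ ℕS.solve 1 (λ K → K :+ K := K :* con 2) refl K ⟩
    K ℕ.* 2                             ≤⟨ ℕP.*-monoʳ-≤ K (ℕP.≤-trans (ℕP.m≤m+n 2 4) (ℕP.*-mono-≤ (ℕP.m≤m+n 3 t) (ℕP.m≤m+n 2 t))) ⟩
    K ℕ.* K                             ∎
    where
    open ℕP.≤-Reasoning
    open ℕS using (_:+_; _:*_; _:=_; con)
    u K : ℕ
    u = 3 ℕ.+ t
    K = u ℕ.* (2 ℕ.+ t)

  gap₁ : ∀ t g n → let u = 3 ℕ.+ t ; v = 2 ℕ.+ t ; K = u ℕ.* v in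
         g ℕ.+ 1 ℕ.< v ℕ.* v → n ≤ u ℕ.+ g → 1 ℕ.* n ℕ.+ 2 ≤ 2 ℕ.* K
  gap₁ t g n g+1<v² n≤u+g = begin
    1 ℕ.* n ℕ.+ 2               ≡⟨ cong (ℕ._+ 2) (ℕP.*-identityˡ n) ⟩
    n ℕ.+ 2                     ≤⟨ ℕP.+-monoˡ-≤ 2 n≤u+g ⟩
    u ℕ.+ g ℕ.+ 2               ≡⟨ ℕS.solve 2 (λ u g → u :+ g :+ con 2 := u :+ (con 1 :+ (g :+ con 1))) refl u g ⟩
    u ℕ.+ suc (g ℕ.+ 1)         ≤⟨ ℕP.+-monoʳ-≤ u g+1<v² ⟩
    u ℕ.+ v ℕ.* v               ≤⟨ ℕP.m≤m+n _ (5 ℕ.+ 5 ℕ.* t ℕ.+ t ℕ.* t) ⟩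
    u ℕ.+ v ℕ.* v ℕ.+ (5 ℕ.+ 5 ℕ.* t ℕ.+ t ℕ.* t)
      ≡⟨ ℕS.solve 1 (λ t → con 3 :+ t :+ (con 2 :+ t) :* (con 2 :+ t) :+ (con 5 :+ con 5 :* t :+ t :* t) := con 2 :* ((con 3 :+ t) :* (con 2 :+ t))) refl t ⟩
    2 ℕ.* K                     ∎
    where
    open ℕP.≤-Reasoning
    open ℕS using (_:+_; _:*_; _:=_; con)
    u v K : ℕ
    u = 3 ℕ.+ t
    v = 2 ℕ.+ t
    K = u ℕ.* v

module _ (γ m : ℚ) (κ≢0 : γ + m ≢ 0ℚ) (a : ℕ → ℚ)
  (a-zero : a 0 ≡ m * m + m) (a-suc : ∀ j → a (suc j) ≡ a j * a j + m) where

  private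
    κ : ℚ
    κ = γ + m
    open ℚS using (solve; con; _:+_; _:*_; _:-_; _:=_)

    module Scaled (q : ℕ) .{{_ : ℕ.NonZero q}} (∣q∣ : ∣ ℕtoℚ q ∣ ≡ ℕtoℚ q) (Γ ν : ℤ) (qγ≡Γ : ℕtoℚ q * γ ≡ ℤtoℚ Γ) (qκ≡ν : ℕtoℚ q * κ ≡ ℤtoℚ ν) where
      -- As m = κ - γ, the number q m inherits integrality from q κ and q γ.
      μ : ℤ
      μ = ν ℤ.- Γ

      u g n : ℕ
      u = ℤ.∣ μ ∣
      g = ℤ.∣ Γ ∣
      n = ℤ.∣ ν ∣

      qm≡μ : ℕtoℚ q * m ≡ ℤtoℚ μ
      qm≡μ = begin
        ℕtoℚ q * m                          ≡⟨ solve 3 (λ q g m → q :* m := q :* (g :+ m) :- q :* g) refl (ℕtoℚ q) γ m ⟩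
        ℕtoℚ q * κ - ℕtoℚ q * γ             ≡⟨ cong₂ _-_ qκ≡ν qγ≡Γ ⟩
        ℤtoℚ ν - ℤtoℚ Γ                     ≡⟨ cong (λ t → ℤtoℚ ν + t) (ℤtoℚ-neg Γ) ⟨
        ℤtoℚ ν + ℤtoℚ (ℤ.- Γ)               ≡⟨ ℤtoℚ-+ ν (ℤ.- Γ) ⟨
        ℤtoℚ μ                              ∎
        where open ≡-Reasoning

      scaled-abs : ∀ x i → ℕtoℚ q * x ≡ ℤtoℚ i → ℕtoℚ q * ∣ x ∣ ≡ ℕtoℚ ℤ.∣ i ∣
      scaled-abs x i e = begin
        ℕtoℚ q * ∣ x ∣        ≡⟨ cong (_* ∣ x ∣) ∣q∣ ⟨
        ∣ ℕtoℚ q ∣ * ∣ x ∣    ≡⟨ ℚP.∣p*q∣≡∣p∣*∣q∣ (ℕtoℚ q) x ⟨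
        ∣ ℕtoℚ q * x ∣        ≡⟨ cong ∣_∣ e ⟩
        ∣ ℤtoℚ i ∣            ≡⟨ ℤtoℚ-∣∣ i ⟨
        ℕtoℚ ℤ.∣ i ∣          ∎
        where open ≡-Reasoning

      n≤u+g : n ≤ u ℕ.+ g
      n≤u+g = ℕP.≤-trans (ℕP.≤-reflexive (cong ℤ.∣_∣ ν≡μ+Γ)) (ℤP.∣i+j∣≤∣i∣+∣j∣ μ Γ)
        where
        ν≡μ+Γ : ν ≡ μ ℤ.+ Γ
        ν≡μ+Γ = sym (trans (ℤP.+-assoc ν (ℤ.- Γ) Γ) (trans (cong (λ t → ν ℤ.+ t) (ℤP.+-inverseˡ Γ)) (ℤP.+-identityʳ ν)))

      nonsquare : ∀ K → (let L = q ℕ.* q ℕ.* q) → K ℕ.+ q ℕ.* u ≤ u ℕ.* u →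
        L ℕ.* (q ℕ.* K) ℕ.+ L ℕ.* L ℕ.* u ≤ K ℕ.* K → L ℕ.* n ℕ.+ 2 ≤ 2 ℕ.* K →
        ∀ j s → s * s ≢ a j * a j + κ
      nonsquare K K≤ growth gap = Orbit.orbit-nonsquare q μ ν K K≤ growth gap m κ qm≡μ qκ≡ν κ≢0 a a-zero a-suc

  nonsquare₄ : ∀ Γ ν → ℕtoℚ 4 * γ ≡ ℤtoℚ Γ → ℕtoℚ 4 * κ ≡ ℤtoℚ ν →
    SqrtLt (∣ γ ∣ + 1ℚ) ((∣ m ∣ - ℤtoℚ (+ 6)) * (+ 1 / 3)) → ∀ j s → s * s ≢ a j * a j + κ
  nonsquare₄ Γ ν qγ≡Γ qκ≡ν (0<r , γ+1<r²) = from-u (ℕP.m≤n⇒∃[o]m+o≡n (ℕP.<⇒≤ 24<u))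
    where
    open Scaled 4 refl Γ ν qγ≡Γ qκ≡ν
    open ≡-Reasoning
    r : ℚ
    r = (∣ m ∣ - ℤtoℚ (+ 6)) * (+ 1 / 3)
    -- The multiplier 12 clears the 3 of r and the 4 of m at once: 12 r = 4 |m| - 24.
    24+12r : ℕtoℚ 24 + ℕtoℚ 12 * r ≡ ℕtoℚ u
    24+12r = trans (solve 1 (λ M → con (ℕtoℚ 24) :+ con (ℕtoℚ 12) :* ((M :- con (ℕtoℚ 6)) :* con (+ 1 / 3)) := con (ℕtoℚ 4) :* M) refl ∣ m ∣)
      (scaled-abs m μ qm≡μ)
    24<u : 24 ℕ.< u
    24<u = ℕtoℚ-cancel-< 24 u (subst (ℕtoℚ 24 <_) 24+12r (ℚP.+-monoʳ-< (ℕtoℚ 24) (ℚP.*-monoʳ-<-pos (ℕtoℚ 12) 0<r)))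
    from-u : (∃ λ v → 24 ℕ.+ v ≡ u) → ∀ j s → s * s ≢ a j * a j + κ
    from-u (v , 24+v≡u) = from-v (ℕP.m≤n⇒∃[o]m+o≡n 13≤v)
      where
      12r≡v : ℕtoℚ 12 * r ≡ ℕtoℚ v
      12r≡v = ℚ-cancelˡ (ℕtoℚ 24) (ℕtoℚ 12 * r) (ℕtoℚ v)
        (trans 24+12r (trans (cong ℕtoℚ (sym 24+v≡u)) (ℕtoℚ-+ 24 v)))
      lhs : ℕtoℚ 144 * (∣ γ ∣ + 1ℚ) ≡ ℕtoℚ (36 ℕ.* g ℕ.+ 144)
      lhs = begin
        ℕtoℚ 144 * (∣ γ ∣ + 1ℚ)                     ≡⟨ solve 1 (λ G → con (ℕtoℚ 144) :* (G :+ con 1ℚ) := con (ℕtoℚ 36) :* (con (ℕtoℚ 4) :* G) :+ con (ℕtoℚ 144)) refl ∣ γ ∣ ⟩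
        ℕtoℚ 36 * (ℕtoℚ 4 * ∣ γ ∣) + ℕtoℚ 144       ≡⟨ cong (λ t → ℕtoℚ 36 * t + ℕtoℚ 144) (scaled-abs γ Γ qγ≡Γ) ⟩
        ℕtoℚ 36 * ℕtoℚ g + ℕtoℚ 144                 ≡⟨ cong (_+ ℕtoℚ 144) (ℕtoℚ-* 36 g) ⟨
        ℕtoℚ (36 ℕ.* g) + ℕtoℚ 144                  ≡⟨ ℕtoℚ-+ (36 ℕ.* g) 144 ⟨
        ℕtoℚ (36 ℕ.* g ℕ.+ 144)                     ∎
      rhs : ℕtoℚ 144 * (r * r) ≡ ℕtoℚ (v ℕ.* v)
      rhs = begin
        ℕtoℚ 144 * (r * r)                  ≡⟨ solve 1 (λ r → con (ℕtoℚ 144) :* (r :* r) := con (ℕtoℚ 12) :* r :* (con (ℕtoℚ 12) :* r)) refl r ⟩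
        ℕtoℚ 12 * r * (ℕtoℚ 12 * r)         ≡⟨ cong (λ t → t * t) 12r≡v ⟩
        ℕtoℚ v * ℕtoℚ v                     ≡⟨ ℕtoℚ-* v v ⟨
        ℕtoℚ (v ℕ.* v)                      ∎
      36g+144<v² : 36 ℕ.* g ℕ.+ 144 ℕ.< v ℕ.* v
      36g+144<v² = ℕtoℚ-cancel-< (36 ℕ.* g ℕ.+ 144) (v ℕ.* v) (subst₂ _<_ lhs rhs (ℚP.*-monoʳ-<-pos (ℕtoℚ 144) γ+1<r²))
      -- Since v² exceeds 144 = 12², v is at least 13; the offsets 37 = 24 + 13 and 33 = 37 - 4
      -- follow.
      13≤v : 13 ≤ v
      13≤v = <-square⇒< 12 v (ℕP.≤-<-trans (ℕP.m≤n+m 144 (36 ℕ.* g)) 36g+144<v²)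
      from-v : (∃ λ t → 13 ℕ.+ t ≡ v) → ∀ j s → s * s ≢ a j * a j + κ
      from-v (t , 13+t≡v) = nonsquare ((37 ℕ.+ t) ℕ.* (33 ℕ.+ t))
        (subst (λ u → K ℕ.+ 4 ℕ.* u ≤ u ℕ.* u) 37+t≡u (ℕP.≤-reflexive
          (ℕS.solve 1 (λ t → (ℕS.con 37 ℕS.:+ t) ℕS.:* (ℕS.con 33 ℕS.:+ t) ℕS.:+ ℕS.con 4 ℕS.:* (ℕS.con 37 ℕS.:+ t) ℕS.:= (ℕS.con 37 ℕS.:+ t) ℕS.:* (ℕS.con 37 ℕS.:+ t)) refl t)))
        (subst (λ u → 64 ℕ.* (4 ℕ.* K) ℕ.+ 64 ℕ.* 64 ℕ.* u ≤ K ℕ.* K) 37+t≡u (growth₄ t))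
        (gap₄ t g n (subst (λ v → 36 ℕ.* g ℕ.+ 144 ℕ.< v ℕ.* v) (sym 13+t≡v) 36g+144<v²) (subst (λ u → n ≤ u ℕ.+ g) (sym 37+t≡u) n≤u+g))
        where
        K : ℕ
        K = (37 ℕ.+ t) ℕ.* (33 ℕ.+ t)
        37+t≡u : 37 ℕ.+ t ≡ u
        37+t≡u = trans (cong (24 ℕ.+_) 13+t≡v) 24+v≡u

  nonsquare₁ : ∀ Γ ν → ℕtoℚ 1 * γ ≡ ℤtoℚ Γ → ℕtoℚ 1 * κ ≡ ℤtoℚ ν →
    SqrtLt (∣ γ ∣ + 1ℚ) (∣ m ∣ - 1ℚ) → ∀ j s → s * s ≢ a j * a j + κ
  nonsquare₁ Γ ν qγ≡Γ qκ≡ν (0<r , γ+1<r²) = from-u (ℕP.m≤n⇒∃[o]m+o≡n (ℕP.<⇒≤ 1<u))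
    where
    open Scaled 1 refl Γ ν qγ≡Γ qκ≡ν
    r : ℚ
    r = ∣ m ∣ - 1ℚ
    1+r : ℕtoℚ 1 + r ≡ ℕtoℚ u
    1+r = trans (solve 1 (λ M → con (ℕtoℚ 1) :+ (M :- con 1ℚ) := con (ℕtoℚ 1) :* M) refl ∣ m ∣)
      (scaled-abs m μ qm≡μ)
    1<u : 1 ℕ.< u
    1<u = ℕtoℚ-cancel-< 1 u (subst (ℕtoℚ 1 <_) 1+r (ℚP.+-monoʳ-< (ℕtoℚ 1) 0<r))
    from-u : (∃ λ v → 1 ℕ.+ v ≡ u) → ∀ j s → s * s ≢ a j * a j + κ
    from-u (v , 1+v≡u) = from-v (ℕP.m≤n⇒∃[o]m+o≡n 2≤v)
      where
      r≡v : r ≡ ℕtoℚ v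
      r≡v = ℚ-cancelˡ (ℕtoℚ 1) r (ℕtoℚ v) (trans 1+r (trans (cong ℕtoℚ (sym 1+v≡u)) (ℕtoℚ-+ 1 v)))
      lhs : ∣ γ ∣ + 1ℚ ≡ ℕtoℚ (g ℕ.+ 1)
      lhs = trans (cong (_+ 1ℚ) (trans (sym (ℚP.*-identityˡ ∣ γ ∣)) (scaled-abs γ Γ qγ≡Γ))) (sym (ℕtoℚ-+ g 1))
      g+1<v² : g ℕ.+ 1 ℕ.< v ℕ.* v
      g+1<v² = ℕtoℚ-cancel-< (g ℕ.+ 1) (v ℕ.* v) (subst₂ _<_ lhs (trans (cong (λ t → t * t) r≡v) (sym (ℕtoℚ-* v v))) γ+1<r²)
      -- Since v² exceeds 1, v is at least 2, and u = v + 1 is at least 3.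
      2≤v : 2 ≤ v
      2≤v = <-square⇒< 1 v (ℕP.≤-<-trans (ℕP.m≤n+m 1 g) g+1<v²)
      from-v : (∃ λ t → 2 ℕ.+ t ≡ v) → ∀ j s → s * s ≢ a j * a j + κ
      from-v (t , 2+t≡v) = nonsquare ((3 ℕ.+ t) ℕ.* (2 ℕ.+ t))
        (subst (λ u → K ℕ.+ 1 ℕ.* u ≤ u ℕ.* u) 3+t≡u (ℕP.≤-reflexive
          (ℕS.solve 1 (λ t → (ℕS.con 3 ℕS.:+ t) ℕS.:* (ℕS.con 2 ℕS.:+ t) ℕS.:+ ℕS.con 1 ℕS.:* (ℕS.con 3 ℕS.:+ t) ℕS.:= (ℕS.con 3 ℕS.:+ t) ℕS.:* (ℕS.con 3 ℕS.:+ t)) refl t)))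
        (subst (λ u → 1 ℕ.* (1 ℕ.* K) ℕ.+ 1 ℕ.* 1 ℕ.* u ≤ K ℕ.* K) 3+t≡u (growth₁ t))
        (gap₁ t g n (subst (λ v → g ℕ.+ 1 ℕ.< v ℕ.* v) (sym 2+t≡v) g+1<v²) (subst (λ u → n ≤ u ℕ.+ g) (sym 3+t≡u) n≤u+g))
        where
        K : ℕ
        K = (3 ℕ.+ t) ℕ.* (2 ℕ.+ t)
        3+t≡u : 3 ℕ.+ t ≡ u
        3+t≡u = trans (cong (1 ℕ.+_) 2+t≡v) 1+v≡u

-- Specialisation to integer coefficients

quad-shape : ∀ B C → let γ = - (½ * B) in
  C ∷ B ∷ 1ℚ ∷ [] ≋ ((- γ ∷ 1ℚ ∷ []) *ₚ (- γ ∷ 1ℚ ∷ [])) +ₚ constₚ (γ + (C - γ * γ - γ))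
quad-shape B C = ∷-cong
  (solve 2 (λ g C → C := (:- g) :* (:- g) :+ con 0ℚ :+ (g :+ (C :- g :* g :- g))) refl (- (½ * B)) C)
  (∷-cong (solve 1 (λ B → B := (:- (:- (con ½ :* B))) :* con 1ℚ :+ (con 1ℚ :* (:- (:- (con ½ :* B))) :+ con 0ℚ)) refl B)
    (∷-cong refl ≋-refl))
  where open ℚS using (solve; con; _:+_; _:*_; _:-_; :-_; _:=_)

theorem4p5 : (b c : ℤ) →
    Irreducible (quadₚ b c) →
    (SqrtLt (∣ gammaOf b ∣ + 1ℚ) ((∣ mOf b c ∣ - ℤtoℚ (+ 6)) * (+ 1 / 3))
    ⊎ (IsInteger (gammaOf b) × SqrtLt (∣ gammaOf b ∣ + 1ℚ) (∣ mOf b c ∣ - 1ℚ))) →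
    (∀ (s : ℚ) → s * s ≡ eval (quadₚ b c) (eval (quadₚ b c) (gammaOf b)) →
    ¬ IsNonzeroRatSquare ((- mOf b c + s) * ½)) →
    Stable (quadₚ b c)
theorem4p5 b c irr bound not-square = stable irr not-square (orbit-nonsquare bound)
  where
  B C γ m : ℚ
  B = ℤtoℚ b
  C = ℤtoℚ c
  γ = gammaOf b
  m = mOf b c
  open StableQuadratic γ m (quadₚ b c) (- γ ∷ 1ℚ ∷ []) (- (γ + m) ∷ 1ℚ ∷ []) ≋-refl ≋-refl (quad-shape B C)
  open ℚS using (solve; con; _:+_; _:*_; _:-_; :-_; _:=_)
  open ≡-Reasoning
  κ≢0 : γ + m ≢ 0ℚ
  κ≢0 = irreducible⇒κ≢0 irr
  -- κ = c - b² / 4 requires the denominator 4; γ = - b / 2 is put over the same 4 so that one q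
  -- serves both.
  4γ≡ : ℕtoℚ 4 * γ ≡ ℤtoℚ (ℤ.- (+ 2 ℤ.* b))
  4γ≡ = begin
    ℕtoℚ 4 * γ                      ≡⟨ solve 1 (λ B → con (ℕtoℚ 4) :* (:- (con ½ :* B)) := :- (con (ℕtoℚ 2) :* B)) refl B ⟩
    - (ℕtoℚ 2 * B)                  ≡⟨ cong -_ (ℤtoℚ-* (+ 2) b) ⟨
    - ℤtoℚ (+ 2 ℤ.* b)              ≡⟨ ℤtoℚ-neg (+ 2 ℤ.* b) ⟨
    ℤtoℚ (ℤ.- (+ 2 ℤ.* b))          ∎
  4κ≡ : ℕtoℚ 4 * (γ + m) ≡ ℤtoℚ (+ 4 ℤ.* c ℤ.+ ℤ.- (b ℤ.* b))
  4κ≡ = begin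
    ℕtoℚ 4 * (γ + m)
      ≡⟨ solve 2 (λ B C → con (ℕtoℚ 4) :* ((:- (con ½ :* B)) :+ (C :- (:- (con ½ :* B)) :* (:- (con ½ :* B)) :- (:- (con ½ :* B))))
           := con (ℕtoℚ 4) :* C :+ (:- (B :* B))) refl B C ⟩
    ℕtoℚ 4 * C + - (B * B)
      ≡⟨ cong₂ _+_ (ℤtoℚ-* (+ 4) c) (trans (ℤtoℚ-neg (b ℤ.* b)) (cong -_ (ℤtoℚ-* b b))) ⟨
    ℤtoℚ (+ 4 ℤ.* c) + ℤtoℚ (ℤ.- (b ℤ.* b))
      ≡⟨ ℤtoℚ-+ (+ 4 ℤ.* c) (ℤ.- (b ℤ.* b)) ⟨
    ℤtoℚ (+ 4 ℤ.* c ℤ.+ ℤ.- (b ℤ.* b)) ∎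
  -- For integral γ the number κ = c - γ² is an integer, and q = 1 will do.
  κ≡ : ∀ k → γ ≡ ℤtoℚ k → ℕtoℚ 1 * (γ + m) ≡ ℤtoℚ (c ℤ.+ ℤ.- (k ℤ.* k))
  κ≡ k γ≡k = begin
    ℕtoℚ 1 * (γ + m)
      ≡⟨ solve 2 (λ g C → con 1ℚ :* (g :+ (C :- g :* g :- g)) := C :+ (:- (g :* g))) refl γ C ⟩
    C + - (γ * γ)
      ≡⟨ cong (λ t → C + - (t * t)) γ≡k ⟩
    C + - (ℤtoℚ k * ℤtoℚ k)
      ≡⟨ cong (λ t → C + t) (trans (ℤtoℚ-neg (k ℤ.* k)) (cong -_ (ℤtoℚ-* k k))) ⟨
    C + ℤtoℚ (ℤ.- (k ℤ.* k))
      ≡⟨ ℤtoℚ-+ c (ℤ.- (k ℤ.* k)) ⟨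
    ℤtoℚ (c ℤ.+ ℤ.- (k ℤ.* k)) ∎
  orbit-nonsquare : SqrtLt (∣ γ ∣ + 1ℚ) ((∣ m ∣ - ℤtoℚ (+ 6)) * (+ 1 / 3)) ⊎ (IsInteger γ × SqrtLt (∣ γ ∣ + 1ℚ) (∣ m ∣ - 1ℚ)) →
    ∀ j s → s * s ≢ orbit j * orbit j + (γ + m)
  orbit-nonsquare (inj₁ large) =
    nonsquare₄ γ m κ≢0 orbit orbit-zero orbit-suc (ℤ.- (+ 2 ℤ.* b)) (+ 4 ℤ.* c ℤ.+ ℤ.- (b ℤ.* b)) 4γ≡ 4κ≡ large
  orbit-nonsquare (inj₂ ((k , γ≡k) , large)) =
    nonsquare₁ γ m κ≢0 orbit orbit-zero orbit-suc k (c ℤ.+ ℤ.- (k ℤ.* k)) (trans (ℚP.*-identityˡ γ) γ≡k) (κ≡ k γ≡k) large
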